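{- Every $U_5$-free tournament $G$ has a transitive subtournament with at least $|V(G)|^{\log_3 2}$ vertices. Moreover, there are infinitely many $U_5$-free tournaments $G$ which have no transitive subtournament with more than $|V(G)|^{\log_3 2}$ vertices.
   Context: A tournament is a finite loopless directed graph in which for any two distinct vertices $u,v$ there is exactly one edge between them; write $u\rightarrow v$ for the edge from $u$ to $v$. A subtournament is a tournament induced on a subset of vertices; it is transitive if it contains no cyclic triangle (three vertices $a\rightarrow b\rightarrow c\rightarrow a$). For tournaments $G,H$, $G$ is $H$-free if no subtournament of $G$ is isomorphic to $H$. $U_5$ is the tournament on $v_1,\dots,v_5$ with $v_2\rightarrow v_1$, and $v_i\rightarrow v_j$ whenever $j-i\equiv 1,2\pmod 5$ and $\{i,j\}\neq\{1,2\}$. -}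

module Defs where

open import Data.Nat using (ℕ; zero; suc; _+_; _∸_; _^_; _≤_; _%_)
open import Data.Fin using (Fin; toℕ)
open import Data.Bool using (Bool; true; false; _∨_)
open import Data.Nat using (_≡ᵇ_)
open import Data.Product using (Σ; _×_; _,_)
open import Data.Sum using (_⊎_)
open import Relation.Nullary using (¬_)
open import Relation.Binary.PropositionalEquality using (_≡_; _≢_)
open import Function.Definitions using (Injective)

record Tournament (n : ℕ) : Set₁ where
  field
    _⟶_      : Fin n → Fin n → Set
    loopless : ∀ u → ¬ (u ⟶ u)
    oneEdge  : ∀ u v → u ≢ v → ((u ⟶ v) × ¬ (v ⟶ u)) ⊎ ((v ⟶ u) × ¬ (u ⟶ v))
open Tournament public

-- The tournament U₅ on Fin 5; vertex i represents v_{i+1}.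
-- v₂ → v₁, and v_i → v_j whenever j - i ≡ 1,2 (mod 5) and {i,j} ≠ {1,2}.
u5 : Fin 5 → Fin 5 → Bool
u5 i j with toℕ i | toℕ j
... | 1 | 0 = true
... | 0 | 1 = false
... | a | b = (((b + 5) ∸ a) % 5 ≡ᵇ 1) ∨ (((b + 5) ∸ a) % 5 ≡ᵇ 2)

ContainsU5 : ∀ {n} → Tournament n → Set
ContainsU5 {n} G =
  Σ (Fin 5 → Fin n) λ f →
    Injective _≡_ _≡_ f ×
    (∀ i j → (_⟶_ G (f i) (f j) → u5 i j ≡ true) × (u5 i j ≡ true → _⟶_ G (f i) (f j)))

U5Free : ∀ {n} → Tournament n → Set
U5Free G = ¬ ContainsU5 G

-- The subtournament induced on the image of f (f injective, so it has m
-- vertices) is transitive: it contains no cyclic triangle.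
TransitiveOn : ∀ {n m} → Tournament n → (Fin m → Fin n) → Set
TransitiveOn {m = m} G f =
  ∀ (a b c : Fin m) →
    ¬ (_⟶_ G (f a) (f b) × _⟶_ G (f b) (f c) × _⟶_ G (f c) (f a))

-- Real exponents encoded via rational approximations of α = log₂ 3
-- (note log₃ 2 = 1/α;  p/q > α  iff  3^q < 2^p;  p/q < α iff 2^p < 3^q).
--
-- AtLeastRoot n k  means  k ≥ n^(log₃ 2), i.e.  n ≤ k^(log₂ 3).
AtLeastRoot : ℕ → ℕ → Set
AtLeastRoot n k = ∀ p q → 3 ^ suc q ≤ 2 ^ p → n ^ suc q ≤ k ^ p

-- AtMostRoot n m  means  m ≤ n^(log₃ 2), i.e.  m^(log₂ 3) ≤ n.
AtMostRoot : ℕ → ℕ → Set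
AtMostRoot n m = m ≡ 0 ⊎ (∀ p q → 2 ^ p ≤ 3 ^ q → m ^ p ≤ n ^ q)

{-# OPTIONS --safe #-}
-- A module of a vertex set W is a subset M on whose vertices every vertex of W outside M
-- agrees.  By contracting modules it suffices to treat prime W, with each vertex carrying a
-- size s and a weight t such that s ≤ t^γ whenever 2^γ ≥ 3.  The key fact is that for each vertex
-- v of a prime U₅-free W there are transitive sets P, Q with P ∪ Q = W and v ∈ P ∩ Q.  Taking v of
-- maximal weight and τ the weight of the heaviest transitive set, this gives
-- t(W) + t(v) ≤ 2τ and t(u) + t(v) ≤ τ for u ≠ v, whence Σ s ≤ τ^γ by convexity.
--
-- If W contains the regular tournament T₅ (U₅ with the edge v₂ → v₁ reversed), then every vertex
-- of W is a twin of a vertex of each copy of T₅, and in- and out-neighbourhoods turn out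
-- transitive, so v with its out-neighbours and v with its in-neighbours will do.
-- Otherwise consider the edges a → b with v → a and b → v.  By primality the bipartite graph they
-- form contains no induced matching of size two, so some c → v is dominated by every such a.
-- Induction on the out-neighbourhood of v together with c, with c in the role of v, splits the
-- out-neighbourhood of v, and dually its in-neighbourhood; the halves are recombined crosswise.
--
-- The bound is attained by the iterated lexicographic powers of the cyclic triangle.
module Submission where

open import Defs
open import Data.Nat using (ℕ; _≤_)
open import Data.Fin using (Fin)
open import Data.Product using (Σ; _×_)
open import Relation.Binary.PropositionalEquality using (_≡_)
open import Function.Definitions using (Injective)

open import Data.Bool using (true; false; if_then_else_)
import Data.Bool.Properties as Bool
open import Data.Empty using (⊥; ⊥-elim)
open import Data.Fin using (zero; suc; remQuot; combine)
open import Data.Fin.Patterns using (0F; 1F; 2F; 3F; 4F)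
import Data.Fin.Properties as Fin
open import Data.Fin.Subset using (Subset; _∈_; _∉_; _⊆_; _⊂_; _∪_; ⁅_⁆; ⊤; ∣_∣) renaming (⊥ to ∅)
open import Data.Fin.Subset.Properties using (∉⊥; _∈?_; _⊆?_; anySubset?; nonempty?; p⊂q⇒∣p∣<∣q∣; ∣⊤∣≡n; x∈p∪q⁺; x∈p∪q⁻; x∈⁅x⁆; x∈⁅y⁆⇒x≡y)
open import Data.Nat using (zero; suc; _+_; _*_; _∸_; _^_; _<_; z≤n; s≤s; NonZero)
open import Data.Nat.Properties
open import Data.Nat.Tactic.RingSolver using (solve-∀)
open import Data.Product using (∃; _,_; proj₁; proj₂)
open import Data.Sum using (_⊎_; inj₁; inj₂; [_,_]′)
open import Data.Unit using (tt)
open import Data.Vec using ([]; _∷_; here; there; lookup; tabulate)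
open import Data.Vec.Properties using (lookup∘tabulate; lookup⇒[]=; []=⇒lookup)
open import Effect.Monad using (RawMonad)
open import Function using (_∘_; const)
open import Level using (0ℓ)
open import Relation.Binary.PropositionalEquality using (_≢_; refl; sym; trans; cong; cong₂; subst; subst₂)
open import Relation.Nullary using (¬_; Dec; yes; no; does; contradiction)
open import Relation.Nullary.Decidable using (_×-dec_; _⊎-dec_; _→-dec_; ¬?; dec-true; toWitness; ¬¬-excluded-middle) renaming (map′ to mapDec)
open import Relation.Nullary.Negation using (¬¬-Monad)
open import Relation.Unary using (Pred; Decidable)
open import Algebra.Properties.CommutativeMonoid.Sum +-0-commutativeMonoid using (sum; ∑-distrib-+; sum-replicate-zero; sum-cong-≗)

-- Sums of rational powers

^-distribʳ-* : ∀ m n o → (m * n) ^ o ≡ m ^ o * n ^ o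
^-distribʳ-* m n zero = refl
^-distribʳ-* m n (suc o) =
  trans (cong (m * n *_) (^-distribʳ-* m n o)) (rearrange m n (m ^ o) (n ^ o))
  where
  rearrange : ∀ a b c d → a * b * (c * d) ≡ a * c * (b * d)
  rearrange = solve-∀

2xy≤x²+y² : ∀ x y → 2 * (x * y) ≤ x * x + y * y
2xy≤x²+y² x y with ≤-total x y
... | inj₁ x≤y = subst (λ z → 2 * (x * z) ≤ x * x + z * z) (m+[n∸m]≡n x≤y)
  (≤-trans (m≤m+n _ ((y ∸ x) * (y ∸ x))) (≤-reflexive (square x (y ∸ x))))
  where
  square : ∀ a b → 2 * (a * (a + b)) + b * b ≡ a * a + (a + b) * (a + b)
  square = solve-∀
... | inj₂ y≤x = subst (λ z → 2 * (z * y) ≤ z * z + y * y) (m+[n∸m]≡n y≤x)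
  (≤-trans (m≤m+n _ ((x ∸ y) * (x ∸ y))) (≤-reflexive (square y (x ∸ y))))
  where
  square : ∀ a b → 2 * ((a + b) * a) + b * b ≡ (a + b) * (a + b) + a * a
  square = solve-∀

-- Bernoulli's inequality for the ratio `b / x`, cleared of denominators. The induction step adds
-- the same terms to both sides, so that `2 * (b * x) ≤ b * b + x * x` replaces any subtraction.
bernoulli : ∀ n b x → suc n * (b * x ^ n) ≤ b ^ suc n + n * x ^ suc n
bernoulli zero b x = ≤-reflexive (base b)
  where
  base : ∀ b → 1 * (b * 1) ≡ b * 1 + 0
  base = solve-∀
bernoulli (suc n) b x = +-cancelʳ-≤ (n * (b * x * u) + suc n * (b * b * u)) _ _ (begin
  suc (suc n) * (b * (x * u)) + (n * (b * x * u) + suc n * (b * b * u))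
    ≡⟨ lhs n b x u ⟩
  b * (suc n * (b * u)) + suc n * u * (2 * (b * x))
    ≤⟨ +-mono-≤ (*-monoʳ-≤ b (bernoulli n b x)) (*-monoʳ-≤ (suc n * u) (2xy≤x²+y² b x)) ⟩
  b * (b * w + n * (x * u)) + suc n * u * (b * b + x * x)
    ≡⟨ rhs n b x u w ⟩
  b * (b * w) + suc n * (x * (x * u)) + (n * (b * x * u) + suc n * (b * b * u)) ∎)
  where
  open ≤-Reasoning
  u = x ^ n
  w = b ^ n
  lhs : ∀ n b x u → suc (suc n) * (b * (x * u)) + (n * (b * x * u) + suc n * (b * b * u))
    ≡ b * (suc n * (b * u)) + suc n * u * (2 * (b * x))
  lhs = solve-∀
  rhs : ∀ n b x u w → b * (b * w + n * (x * u)) + suc n * u * (b * b + x * x)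
    ≡ b * (b * w) + suc n * (x * (x * u)) + (n * (b * x * u) + suc n * (b * b * u))
  rhs = solve-∀

-- AM-GM for `m` copies of `s / m` and one `y`. Bernoulli's inequality is applied to `m * (s + y)`
-- and `suc m * s`, which agree exactly when `m * y` is `s`, the case of equality.
amgm-step : ∀ m s y → suc m ^ suc m * (s ^ m * y) ≤ m ^ m * (s + y) ^ suc m
amgm-step zero s y = subst₂ _≤_ (l s y) (r s y) (m≤n+m y s)
  where
  l : ∀ s y → y ≡ 1 * 1 * (1 * y)
  l = solve-∀
  r : ∀ s y → s + y ≡ 1 * ((s + y) * 1)
  r = solve-∀
amgm-step m@(suc _) s y = *-cancelˡ-≤ m (+-cancelʳ-≤ (m * x ^ suc m) _ _ (begin
  m * (suc m * suc m ^ m * (s ^ m * y)) + m * (x * x ^ m)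
    ≡⟨ cong (λ z → m * (suc m * suc m ^ m * (s ^ m * y)) + m * (x * z)) x^m ⟩
  m * (suc m * suc m ^ m * (s ^ m * y)) + m * (x * (suc m ^ m * s ^ m))
    ≡⟨ lhs m s y (suc m ^ m) (s ^ m) ⟩
  suc m * ((m * (s + y)) * (suc m ^ m * s ^ m))
    ≡⟨ cong (λ z → suc m * ((m * (s + y)) * z)) (sym x^m) ⟩
  suc m * ((m * (s + y)) * x ^ m)
    ≤⟨ bernoulli m (m * (s + y)) x ⟩
  (m * (s + y)) ^ suc m + m * x ^ suc m
    ≡⟨ cong (_+ m * x ^ suc m) (trans (^-distribʳ-* m (s + y) (suc m)) (*-assoc m (m ^ m) _)) ⟩
  m * (m ^ m * (s + y) ^ suc m) + m * x ^ suc m ∎))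
  where
  open ≤-Reasoning
  x = suc m * s
  x^m = ^-distribʳ-* (suc m) s m
  lhs : ∀ m s y a b → m * (suc m * a * (b * y)) + m * (suc m * s * (a * b))
    ≡ suc m * ((m * (s + y)) * (a * b))
  lhs = solve-∀

-- Weighted AM-GM: for `k` copies of `z` alone there is equality, and the copies of `y` are added
-- one at a time by `amgm-step`.
amgm : ∀ r k y z → (r + k) ^ (r + k) * (y ^ r * z ^ k) ≤ (k * z + r * y) ^ (r + k)
amgm zero k y z = ≤-reflexive (trans (cong (k ^ k *_) (*-identityˡ (z ^ k)))
  (trans (sym (^-distribʳ-* k z k)) (cong (_^ k) (sym (+-identityʳ (k * z))))))
amgm (suc r) k y z = *-cancelˡ-≤ (m ^ m) {{m^m≢0 m}} (begin
  m ^ m * (suc m ^ suc m * (y * y ^ r * z ^ k))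
    ≡⟨ rearrange (m ^ m) (suc m ^ suc m) y (y ^ r) (z ^ k) ⟩
  suc m ^ suc m * (m ^ m * (y ^ r * z ^ k) * y)
    ≤⟨ *-monoʳ-≤ (suc m ^ suc m) (*-monoˡ-≤ y (amgm r k y z)) ⟩
  suc m ^ suc m * ((k * z + r * y) ^ m * y)
    ≤⟨ amgm-step m (k * z + r * y) y ⟩
  m ^ m * ((k * z + r * y) + y) ^ suc m
    ≡⟨ cong (λ s → m ^ m * s ^ suc m) (trans (+-assoc (k * z) (r * y) y) (cong (k * z +_) (+-comm (r * y) y))) ⟩
  m ^ m * (k * z + suc r * y) ^ suc m ∎)
  where
  open ≤-Reasoning
  m = r + k
  m^m≢0 : ∀ m → NonZero (m ^ m)
  m^m≢0 zero = _
  m^m≢0 (suc m) = m^n≢0 (suc m) (suc m)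
  rearrange : ∀ a b y c d → a * (b * (y * c * d)) ≡ b * (a * (c * d) * y)
  rearrange = solve-∀

-- With A = a^q and D = d^q this reads  s · a ≤ t · d,  so inequalities between
-- q-th roots can be added and scaled without leaving ℕ.
record RootLe (q A D s t : ℕ) : Set where
  constructor rootLe
  field powers : s ^ q * A ≤ t ^ q * D
open RootLe

module _ {A D q : ℕ} .{{_ : NonZero q}} where

  private
    0^q : 0 ^ q ≡ 0
    0^q = m*n≡0⇒m≡0 (0 ^ q) 1 (trans (*-identityʳ (0 ^ q)) (zeroPow q))
      where
      zeroPow : ∀ n .{{_ : NonZero n}} → 0 ^ n ≡ 0
      zeroPow (suc n) = refl

  rootLe-scale : ∀ c {s t} → RootLe q A D s t → RootLe q A D (c * s) (c * t)
  rootLe-scale c {s} {t} (rootLe p) = rootLe (begin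
    (c * s) ^ q * A    ≡⟨ cong (_* A) (^-distribʳ-* c s q) ⟩
    c ^ q * s ^ q * A  ≡⟨ *-assoc (c ^ q) _ _ ⟩
    c ^ q * (s ^ q * A) ≤⟨ *-monoʳ-≤ (c ^ q) p ⟩
    c ^ q * (t ^ q * D) ≡⟨ *-assoc (c ^ q) _ _ ⟨
    c ^ q * t ^ q * D  ≡⟨ cong (_* D) (^-distribʳ-* c t q) ⟨
    (c * t) ^ q * D    ∎)
    where open ≤-Reasoning

  rootLe-cancel : ∀ c .{{_ : NonZero c}} {s t} → RootLe q A D (c * s) (c * t) → RootLe q A D s t
  rootLe-cancel c {s} {t} (rootLe p) = rootLe (*-cancelˡ-≤ (c ^ q) {{m^n≢0 c q}} (begin
    c ^ q * (s ^ q * A) ≡⟨ *-assoc (c ^ q) _ _ ⟨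
    c ^ q * s ^ q * A  ≡⟨ cong (_* A) (^-distribʳ-* c s q) ⟨
    (c * s) ^ q * A    ≤⟨ p ⟩
    (c * t) ^ q * D    ≡⟨ cong (_* D) (^-distribʳ-* c t q) ⟩
    c ^ q * t ^ q * D  ≡⟨ *-assoc (c ^ q) _ _ ⟩
    c ^ q * (t ^ q * D) ∎))
    where open ≤-Reasoning

  rootLe-mono : ∀ {s s′ t t′} → s′ ≤ s → t ≤ t′ → RootLe q A D s t → RootLe q A D s′ t′
  rootLe-mono s′≤s t≤t′ (rootLe p) = rootLe
    (≤-trans (*-monoˡ-≤ A (^-monoˡ-≤ q s′≤s)) (≤-trans p (*-monoˡ-≤ D (^-monoˡ-≤ q t≤t′))))

  rootLe-zero : ∀ {t} → RootLe q A D 0 t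
  rootLe-zero {t} = rootLe (subst (_≤ t ^ q * D) (sym (cong (_* A) 0^q)) z≤n)

  private
    -- The hypothesis orders the ratios as s′/t′ ≤ s/t, so the mediant (s + s′)/(t + t′) is at most
    -- s/t, which the first inequality bounds. If `t` is zero, that inequality forces `s` or `A` to
    -- be zero.
    addLe : ∀ {s t s′ t′} → s′ * t ≤ s * t′ → RootLe q A D s t → RootLe q A D s′ t′ →
      RootLe q A D (s + s′) (t + t′)
    addLe {s} {zero} {s′} {t′} _ (rootLe p) p′ with s ^ q * A in eq
    ... | suc _ = contr p
      where
      contr : ∀ {ℓ} {B : Set ℓ} {n} → suc n ≤ 0 ^ q * D → B
      contr {n = n} le with () ← n≤0⇒n≡0 (subst (suc n ≤_) (cong (_* D) 0^q) le)
    ... | zero with m*n≡0⇒m≡0∨n≡0 (s ^ q) eq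
    ...   | inj₁ s^q≡0 with refl ← m^n≡0⇒m≡0 s q s^q≡0 = p′
    ...   | inj₂ refl = rootLe (subst (_≤ t′ ^ q * D) (sym (*-zeroʳ ((s + s′) ^ q))) z≤n)
    addLe {s} {t@(suc _)} {s′} {t′} le p _ = rootLe-cancel t
      (rootLe-mono (begin
        t * (s + s′)    ≡⟨ expand t s s′ ⟩
        s * t + s′ * t  ≤⟨ +-monoʳ-≤ (s * t) le ⟩
        s * t + s * t′  ≡⟨ collect s t t′ ⟩
        (t + t′) * s    ∎) (≤-reflexive (*-comm (t + t′) t)) (rootLe-scale (t + t′) p))
      where
      open ≤-Reasoning
      expand : ∀ t s s′ → t * (s + s′) ≡ s * t + s′ * t
      expand = solve-∀
      collect : ∀ s t t′ → s * t + s * t′ ≡ (t + t′) * s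
      collect = solve-∀

  rootLe-add : ∀ {s t s′ t′} → RootLe q A D s t → RootLe q A D s′ t′ → RootLe q A D (s + s′) (t + t′)
  rootLe-add {s} {t} {s′} {t′} p p′ with ≤-total (s′ * t) (s * t′)
  ... | inj₁ le = addLe le p p′
  ... | inj₂ le = subst₂ (RootLe q A D) (+-comm s′ s) (+-comm t′ t) (addLe le p′ p)

module _ (r k : ℕ) .{{_ : NonZero (r + k)}} (3^q≤2^p : 3 ^ (r + k) ≤ 2 ^ (r + k) * 2 ^ r) where

  private
    q = r + k

  -- With `q = r + k` and γ = 1 + r/q, the module hypothesis reads 3 ≤ 2^γ. The inequality says that
  -- the tangent at `z` of the concave function x^(r/q) lies above it at `y`; it is `amgm`
  -- multiplied by `z ^ r`.
  weightedMean : ∀ y z → RootLe q (y ^ r) (z ^ r) (q * z) (k * z + r * y)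
  weightedMean y z = rootLe (begin
    (q * z) ^ q * y ^ r             ≡⟨ cong (_* y ^ r) (^-distribʳ-* q z q) ⟩
    q ^ q * z ^ (r + k) * y ^ r     ≡⟨ cong (λ w → q ^ q * w * y ^ r) (^-distribˡ-+-* z r k) ⟩
    q ^ q * (z ^ r * z ^ k) * y ^ r ≡⟨ rearrange (q ^ q) (z ^ r) (z ^ k) (y ^ r) ⟩
    q ^ q * (y ^ r * z ^ k) * z ^ r ≤⟨ *-monoˡ-≤ (z ^ r) (amgm r k y z) ⟩
    (k * z + r * y) ^ q * z ^ r     ∎)
    where
    open ≤-Reasoning
    rearrange : ∀ a b c d → a * (b * c) * d ≡ a * (d * c) * b
    rearrange = solve-∀

  -- 1 + x/2 ≤ (1 + x)^(r/q)  for  x = d/a ∈ [0,1]: the right side is concave and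
  -- 2^(r/q) ≥ 3/2.
  chord : ∀ a d → d ≤ a → RootLe q (a ^ r) ((a + d) ^ r) (2 * a + d) (2 * a)
  chord zero zero z≤n = rootLe-zero
  chord a@(suc _) d d≤a = rootLe-cancel (q * z) {{m*n≢0 q z}}
    -- Since `z` is the mean of `a` and `2 * a` with weights `e` and `d`, the tangent at `z`, taken
    -- at these two points with these weights, averages to its value at `z`. At `2 * a` the factor
    -- 2^(r/q) contributes at least 3/2 (`doubled`), which turns `2 * e + 2 * d` into
    -- `2 * e + 3 * d`, that is `2 * a + d`.
    (subst₂ (RootLe q _ _) lhs rhs
      (rootLe-add (rootLe-scale (2 * e) (weightedMean a z)) doubled))
    where
    open ≤-Reasoning
    z = a + d
    e = a ∸ d
    a≡d+e : a ≡ d + e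
    a≡d+e = sym (m+[n∸m]≡n d≤a)
    doubled : RootLe q (a ^ r) (z ^ r) (3 * (d * (q * z))) (2 * (d * (k * z + r * (2 * a))))
    doubled = rootLe (begin
      (3 * (d * (q * z))) ^ q * a ^ r
        ≡⟨ cong (_* a ^ r) (^-distribʳ-* 3 (d * (q * z)) q) ⟩
      3 ^ q * (d * (q * z)) ^ q * a ^ r
        ≤⟨ *-monoˡ-≤ (a ^ r) (*-monoˡ-≤ ((d * (q * z)) ^ q) 3^q≤2^p) ⟩
      2 ^ q * 2 ^ r * (d * (q * z)) ^ q * a ^ r
        ≡⟨ rearrange (2 ^ q) (2 ^ r) ((d * (q * z)) ^ q) (a ^ r) ⟩
      2 ^ q * ((d * (q * z)) ^ q * (2 ^ r * a ^ r))
        ≡⟨ cong (λ w → 2 ^ q * ((d * (q * z)) ^ q * w)) (^-distribʳ-* 2 a r) ⟨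
      2 ^ q * ((d * (q * z)) ^ q * (2 * a) ^ r)
        ≤⟨ *-monoʳ-≤ (2 ^ q) (powers (rootLe-scale d (weightedMean (2 * a) z))) ⟩
      2 ^ q * ((d * (k * z + r * (2 * a))) ^ q * z ^ r)
        ≡⟨ *-assoc (2 ^ q) _ _ ⟨
      2 ^ q * (d * (k * z + r * (2 * a))) ^ q * z ^ r
        ≡⟨ cong (_* z ^ r) (^-distribʳ-* 2 (d * (k * z + r * (2 * a))) q) ⟨
      (2 * (d * (k * z + r * (2 * a)))) ^ q * z ^ r ∎)
      where
      rearrange : ∀ a b c d → a * b * c * d ≡ a * (c * (b * d))
      rearrange = solve-∀
    lhs : 2 * e * (q * z) + 3 * (d * (q * z)) ≡ q * z * (2 * a + d)
    lhs = trans (identity e d (q * z)) (cong (λ w → q * z * (2 * w + d)) (sym a≡d+e))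
      where
      identity : ∀ e d w → 2 * e * w + 3 * (d * w) ≡ w * (2 * (d + e) + d)
      identity = solve-∀
    rhs : 2 * e * (k * z + r * a) + 2 * (d * (k * z + r * (2 * a))) ≡ q * z * (2 * a)
    rhs = trans (cong (λ w → 2 * e * (k * (w + d) + r * w) + 2 * (d * (k * (w + d) + r * (2 * w)))) a≡d+e)
      (trans (identity e d k r) (cong (λ w → q * (w + d) * (2 * w)) (sym a≡d+e)))
      where
      identity : ∀ e d k r → 2 * e * (k * (d + e + d) + r * (d + e)) + 2 * (d * (k * (d + e + d) + r * (2 * (d + e))))
        ≡ (r + k) * (d + e + d) * (2 * (d + e))
      identity = solve-∀

  private
    3d^r : ∀ d u → 2 * d ≤ u → RootLe q (d ^ r) (u ^ r) 3 2
    3d^r d u 2d≤u = rootLe (begin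
      3 ^ q * d ^ r           ≤⟨ *-monoˡ-≤ (d ^ r) 3^q≤2^p ⟩
      2 ^ q * 2 ^ r * d ^ r   ≡⟨ *-assoc (2 ^ q) _ _ ⟩
      2 ^ q * (2 ^ r * d ^ r) ≡⟨ cong (2 ^ q *_) (^-distribʳ-* 2 d r) ⟨
      2 ^ q * (2 * d) ^ r     ≤⟨ *-monoʳ-≤ (2 ^ q) (^-monoˡ-≤ r 2d≤u) ⟩
      2 ^ q * u ^ r           ∎)
      where open ≤-Reasoning

    compose : ∀ {A B C s t u v} → RootLe q A B s t → RootLe q B C u v → RootLe q A C (u * s) (v * t)
    compose {A} {B} {C} {s} {t} {u} {v} (rootLe p) (rootLe p′) = rootLe (begin
      (u * s) ^ q * A     ≡⟨ cong (_* A) (^-distribʳ-* u s q) ⟩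
      u ^ q * s ^ q * A   ≡⟨ *-assoc (u ^ q) _ _ ⟩
      u ^ q * (s ^ q * A) ≤⟨ *-monoʳ-≤ (u ^ q) p ⟩
      u ^ q * (t ^ q * B) ≡⟨ rearrange (u ^ q) (t ^ q) B ⟩
      t ^ q * (u ^ q * B) ≤⟨ *-monoʳ-≤ (t ^ q) p′ ⟩
      t ^ q * (v ^ q * C) ≡⟨ rearrange (t ^ q) (v ^ q) C ⟩
      v ^ q * (t ^ q * C) ≡⟨ *-assoc (v ^ q) _ _ ⟨
      v ^ q * t ^ q * C   ≡⟨ cong (_* C) (^-distribʳ-* v t q) ⟨
      (v * t) ^ q * C     ∎)
      where
      open ≤-Reasoning
      rearrange : ∀ a b c → a * (b * c) ≡ b * (a * c)
      rearrange = solve-∀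

  -- a^γ + 2 d^γ ≤ (a + d)^γ  for  d ≤ a  and  γ = 1 + r/q.
  heavyBound : ∀ {a d s S} → d ≤ a → RootLe q 1 (a ^ r) s a → RootLe q 1 (d ^ r) S (2 * d) →
    RootLe q 1 ((a + d) ^ r) (s + S) (a + d)
  heavyBound {zero} {zero} {s} {S} z≤n p p′ = rootLe-mono (≤-refl {s + S}) z≤n (rootLe-add p p′)
  -- Relative to (a + d)^(r/q), `chord` bounds a^(r/q) by the factor 2a/(2a + d), and `3d^r` bounds
  -- d^(r/q) by 2/3. Cleared of denominators, what remains is `d * d ≤ a * d`.
  heavyBound {a@(suc _)} {d} {s} {S} d≤a p p′ = rootLe-cancel (3 * (2 * a + d))
    (rootLe-mono (≤-reflexive (lhs a d s S)) rhs
      (rootLe-add (rootLe-scale 3 (compose p (chord a d d≤a)))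
                  (rootLe-scale (2 * a + d) (compose p′ (3d^r d (a + d) 2d≤a+d)))))
    where
    2d≤a+d : 2 * d ≤ a + d
    2d≤a+d = subst (_≤ a + d) (cong (d +_) (sym (+-identityʳ d))) (+-monoˡ-≤ d d≤a)
    lhs : ∀ a d s S → 3 * (2 * a + d) * (s + S) ≡ 3 * ((2 * a + d) * s) + (2 * a + d) * (3 * S)
    lhs = solve-∀
    rhs : 3 * (2 * a * a) + (2 * a + d) * (2 * (2 * d)) ≤ 3 * (2 * a + d) * (a + d)
    rhs = begin
      3 * (2 * a * a) + (2 * a + d) * (2 * (2 * d)) ≡⟨ l a d ⟩
      6 * (a * a) + 8 * (a * d) + 3 * (d * d) + d * d ≤⟨ +-monoʳ-≤ (6 * (a * a) + 8 * (a * d) + 3 * (d * d)) (*-monoˡ-≤ d d≤a) ⟩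
      6 * (a * a) + 8 * (a * d) + 3 * (d * d) + a * d ≡⟨ r′ a d ⟩
      3 * (2 * a + d) * (a + d) ∎
      where
      open ≤-Reasoning
      l : ∀ a d → 3 * (2 * a * a) + (2 * a + d) * (2 * (2 * d)) ≡ 6 * (a * a) + 8 * (a * d) + 3 * (d * d) + d * d
      l = solve-∀
      r′ : ∀ a d → 6 * (a * a) + 8 * (a * d) + 3 * (d * d) + a * d ≡ 3 * (2 * a + d) * (a + d)
      r′ = solve-∀

  private
    -- From 2^3 ≤ 3^2 ≤ 2^(2γ) follows γ ≥ 3/2, so r/q is at least one half.
    k≤r : k ≤ r
    k≤r = +-cancelˡ-≤ r _ _ (≮⇒≥ λ 2r<q → <⇒≱ (^-monoʳ-< 2 (s≤s (s≤s z≤n)) (bound 2r<q)) (begin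
      2 ^ (3 * q)                     ≡⟨ ^-*-assoc 2 3 q ⟨
      8 ^ q                           ≤⟨ ^-monoˡ-≤ q (n≤1+n 8) ⟩
      9 ^ q                           ≡⟨ ^-distribʳ-* 3 3 q ⟩
      3 ^ q * 3 ^ q                   ≤⟨ *-mono-≤ 3^q≤2^p 3^q≤2^p ⟩
      2 ^ q * 2 ^ r * (2 ^ q * 2 ^ r) ≡⟨ cong (λ w → w * w) (^-distribˡ-+-* 2 q r) ⟨
      2 ^ (q + r) * 2 ^ (q + r)       ≡⟨ ^-distribˡ-+-* 2 (q + r) (q + r) ⟨
      2 ^ (q + r + (q + r))           ∎))
      where
      open ≤-Reasoning
      bound : r + r < q → q + r + (q + r) < 3 * q
      bound 2r<q = subst₂ _<_ (l q r) (m q) (+-monoʳ-< (q + q) 2r<q)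
        where
        l : ∀ q r → q + q + (r + r) ≡ q + r + (q + r)
        l = solve-∀
        m : ∀ q → q + q + q ≡ 3 * q
        m = solve-∀

  -- (2 - x) x^(r/q) ≤ 1  for  x = a/τ ≤ 1/2.
  lightBound : ∀ {a τ R S} → 2 * a ≤ τ → R + a ≤ 2 * τ → RootLe q 1 (a ^ r) S R →
    RootLe q 1 (τ ^ r) S τ
  lightBound {a} {zero} {R} {S} 2a≤τ R+a≤2τ p with refl ← m+n≡0⇒m≡0 a (n≤0⇒n≡0 2a≤τ) =
    rootLe-mono ≤-refl (≤-trans (m≤m+n R 0) R+a≤2τ) p
  lightBound {a} {τ@(suc _)} {R} {S} 2a≤τ R+a≤2τ p =
    rootLe-cancel (3 * (q * τ)) {{m*n≢0 3 (q * τ) {{_}} {{m*n≢0 q τ}}}}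
      (rootLe-mono ≤-refl bound (compose p scaled))
    where
    open ≤-Reasoning
    f = τ ∸ 2 * a
    τ≡ : τ ≡ 2 * a + f
    τ≡ = sym (m+[n∸m]≡n 2a≤τ)
    -- First a^(r/q) is at most 2/3 of (2a)^(r/q); then (2a)^(r/q) is compared with τ^(r/q) by the
    -- tangent at `τ`. For 2^γ = 3 and `2 * a` equal to `τ` both are equalities.
    scaled : RootLe q (a ^ r) (τ ^ r) (3 * (q * τ)) (2 * (k * τ + r * (2 * a)))
    scaled = subst₂ (RootLe q _ _) (*-comm (q * τ) 3) (*-comm (k * τ + r * (2 * a)) 2)
      (compose (3d^r a (2 * a) ≤-refl) (weightedMean (2 * a) τ))
    R≤ : R ≤ 3 * a + 2 * f
    R≤ = +-cancelʳ-≤ a _ _ (≤-trans R+a≤2τ (≤-reflexive (trans (cong (2 *_) τ≡) (identity a f))))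
      where
      identity : ∀ a f → 2 * (2 * a + f) ≡ 3 * a + 2 * f + a
      identity = solve-∀
    bound : 2 * (k * τ + r * (2 * a)) * R ≤ 3 * (q * τ) * τ
    bound = begin
      2 * (k * τ + r * (2 * a)) * R
        ≤⟨ *-monoʳ-≤ (2 * (k * τ + r * (2 * a))) R≤ ⟩
      2 * (k * τ + r * (2 * a)) * (3 * a + 2 * f)
        ≡⟨ cong (λ w → 2 * (k * w + r * (2 * a)) * (3 * a + 2 * f)) τ≡ ⟩
      2 * (k * (2 * a + f) + r * (2 * a)) * (3 * a + 2 * f)
        ≡⟨ lhs a f k r ⟩
      k * (12 * (a * a) + 12 * (a * f) + 3 * (f * f)) + r * (12 * (a * a) + 8 * (a * f)) + k * (2 * (a * f) + f * f)
        -- `k ≤ r` moves the last term from `k` to `r`; the slack 2af + 2f² then gives `r` the same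
        -- coefficient as `k`, namely 3(2a + f)².
        ≤⟨ +-monoʳ-≤ (k * (12 * (a * a) + 12 * (a * f) + 3 * (f * f)) + r * (12 * (a * a) + 8 * (a * f)))
             (*-mono-≤ k≤r (m≤m+n (2 * (a * f) + f * f) (2 * (a * f) + 2 * (f * f)))) ⟩
      k * (12 * (a * a) + 12 * (a * f) + 3 * (f * f)) + r * (12 * (a * a) + 8 * (a * f))
        + r * (2 * (a * f) + f * f + (2 * (a * f) + 2 * (f * f)))
        ≡⟨ rhs a f k r ⟩
      3 * (q * (2 * a + f)) * (2 * a + f)
        ≡⟨ cong (λ w → 3 * (q * w) * w) τ≡ ⟨
      3 * (q * τ) * τ ∎
      where
      lhs : ∀ a f k r → 2 * (k * (2 * a + f) + r * (2 * a)) * (3 * a + 2 * f)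
        ≡ k * (12 * (a * a) + 12 * (a * f) + 3 * (f * f)) + r * (12 * (a * a) + 8 * (a * f)) + k * (2 * (a * f) + f * f)
      lhs = solve-∀
      rhs : ∀ a f k r → k * (12 * (a * a) + 12 * (a * f) + 3 * (f * f)) + r * (12 * (a * a) + 8 * (a * f))
        + r * (2 * (a * f) + f * f + (2 * (a * f) + 2 * (f * f))) ≡ 3 * ((r + k) * (2 * a + f)) * (2 * a + f)
      rhs = solve-∀

-- Modules, and prime tournaments containing T₅

module _ {n : ℕ} {P : Pred (Fin n) 0ℓ} where

  ⟪_⟫ : Decidable P → Subset n
  ⟪ P? ⟫ = tabulate (does ∘ P?)

  ∈⟪⟫⁺ : (P? : Decidable P) → ∀ {x} → P x → x ∈ ⟪ P? ⟫
  ∈⟪⟫⁺ P? {x} px = lookup⇒[]= x _ (trans (lookup∘tabulate (does ∘ P?) x) (dec-true (P? x) px))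

  ∈⟪⟫⁻ : (P? : Decidable P) → ∀ {x} → x ∈ ⟪ P? ⟫ → P x
  ∈⟪⟫⁻ P? {x} x∈ with P? x | trans (sym (lookup∘tabulate (does ∘ P?) x)) ([]=⇒lookup x∈)
  ... | yes px | _ = px
  ... | no _   | ()

module _ {n : ℕ} (G : Tournament n) where

  private
    _⇒_ = _⟶_ G

  op : Tournament n
  op = record
    { _⟶_ = λ x y → y ⇒ x
    ; loopless = loopless G
    ; oneEdge = λ u v u≢v → oneEdge G v u (u≢v ∘ sym)
    }

  compare : ∀ x y → x ≡ y ⊎ (x ⇒ y ⊎ y ⇒ x)
  compare x y with x Fin.≟ y
  ... | yes x≡y = inj₁ x≡y
  ... | no x≢y with oneEdge G x y x≢y
  ...   | inj₁ (x⇒y , _) = inj₂ (inj₁ x⇒y)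
  ...   | inj₂ (y⇒x , _) = inj₂ (inj₂ y⇒x)

  asym : ∀ {x y} → x ⇒ y → y ⇒ x → ⊥
  asym {x} {y} x⇒y y⇒x with x Fin.≟ y
  ... | yes refl = loopless G x x⇒y
  ... | no x≢y with oneEdge G x y x≢y
  ...   | inj₁ (_ , y⇏x) = y⇏x y⇒x
  ...   | inj₂ (_ , x⇏y) = x⇏y x⇒y

  edge? : ∀ x y → Dec (x ⇒ y)
  edge? x y with compare x y
  ... | inj₁ refl = no (loopless G x)
  ... | inj₂ (inj₁ x⇒y) = yes x⇒y
  ... | inj₂ (inj₂ y⇒x) = no (asym y⇒x)

  -- The ten edges of U₅ as separate arguments. They force the five vertices to be distinct, so that
  -- no embedding has to be built at each use.
  NoU5 : Set
  NoU5 = ∀ {v₁ v₂ v₃ v₄ v₅} → v₂ ⇒ v₁ → v₁ ⇒ v₃ → v₂ ⇒ v₃ → v₂ ⇒ v₄ → v₃ ⇒ v₄ → v₃ ⇒ v₅ →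
    v₄ ⇒ v₅ → v₄ ⇒ v₁ → v₅ ⇒ v₁ → v₅ ⇒ v₂ → ⊥

  Acyclic : Subset n → Set
  Acyclic T = ∀ {x y z} → x ∈ T → y ∈ T → z ∈ T → x ⇒ y → y ⇒ z → z ⇒ x → ⊥

  record IsModule (W M : Subset n) : Set where
    field
      ⊆W : M ⊆ W
      hom : ∀ {x p q} → x ∈ W → x ∉ M → p ∈ M → q ∈ M → x ⇒ p → x ⇒ q

    hom′ : ∀ {x p q} → x ∈ W → x ∉ M → p ∈ M → q ∈ M → p ⇒ x → q ⇒ x
    hom′ {x} {p} {q} x∈W x∉M p∈M q∈M p⇒x with compare x q
    ... | inj₁ refl = contradiction q∈M x∉M
    ... | inj₂ (inj₁ x⇒q) = ⊥-elim (asym p⇒x (hom x∈W x∉M q∈M p∈M x⇒q))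
    ... | inj₂ (inj₂ q⇒x) = q⇒x

  Prime : Subset n → Set
  Prime W = ∀ {M} → IsModule W M → ∀ {x y} → x ∈ M → y ∈ M → x ≢ y → W ⊆ M

  -- The set spanned by the triangles reachable from x y z by steps that replace one
  -- vertex.  No vertex w of W outside it forms a cyclic triangle with an edge inside,
  -- so the relation of w to one end of such an edge passes to the other end.
  data Closure (W : Subset n) (x y z : Fin n) : Pred (Fin n) 0ℓ where
    fst : Closure W x y z x
    snd : Closure W x y z y
    thd : Closure W x y z z
    add : ∀ {q r w} → Closure W x y z q → Closure W x y z r → w ∈ W →
      q ⇒ r → r ⇒ w → w ⇒ q → Closure W x y z w

  module _ {W : Subset n} {x y z : Fin n} (x⇒y : x ⇒ y) (y⇒z : y ⇒ z) (z⇒x : z ⇒ x) where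

    private
      Cl = Closure W x y z

      module _ {w : Fin n} (w∈W : w ∈ W) (w∉Cl : ¬ Cl w) where

        forth : ∀ {q r} → Cl q → Cl r → q ⇒ r → w ⇒ q → w ⇒ r
        forth {q} {r} cq cr q⇒r w⇒q with compare w r
        ... | inj₁ refl = contradiction cr w∉Cl
        ... | inj₂ (inj₁ w⇒r) = w⇒r
        ... | inj₂ (inj₂ r⇒w) = contradiction (add cq cr w∈W q⇒r r⇒w w⇒q) w∉Cl

        spread : w ⇒ x → ∀ {p} → Cl p → w ⇒ p
        spread w⇒x fst = w⇒x
        spread w⇒x snd = forth fst snd x⇒y w⇒x
        spread w⇒x thd = forth snd thd y⇒z (forth fst snd x⇒y w⇒x)
        spread w⇒x c@(add cq cr _ q⇒r r⇒p p⇒q) = forth cr c r⇒p (spread w⇒x cr)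

        gather : ∀ {p} → Cl p → w ⇒ p → w ⇒ x
        gather fst w⇒p = w⇒p
        gather snd w⇒p = forth thd fst z⇒x (forth snd thd y⇒z w⇒p)
        gather thd w⇒p = forth thd fst z⇒x w⇒p
        gather c@(add cq cr _ q⇒r r⇒p p⇒q) w⇒p = gather cq (forth c cq p⇒q w⇒p)

    -- `Closure` is an inductive predicate with no decision procedure at hand, whereas a module is a
    -- `Subset`. Under double negation its membership may be decided for all of the finitely many
    -- vertices, and every use ends in a contradiction. `Z` is an invariant of the steps, chosen so
    -- that a module inside it is impossible.
    closureModule : x ∈ W → y ∈ W → z ∈ W → {Z : Pred (Fin n) 0ℓ} → Z x → Z y → Z z →
      (∀ {q r w} → Z q → Z r → w ∈ W → q ⇒ r → r ⇒ w → w ⇒ q → Z w) →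
      ¬ ¬ Σ (Subset n) λ M → IsModule W M × x ∈ M × y ∈ M × z ∈ M × (∀ {p} → p ∈ M → Z p)
    closureModule x∈W y∈W z∈W {Z} zx zy zz closed noModule =
      Fin.sequence (RawMonad.rawApplicative ¬¬-Monad) (λ p → ¬¬-excluded-middle) λ Cl? →
        noModule (⟪ Cl? ⟫ , isModule Cl? , ∈⟪⟫⁺ Cl? fst , ∈⟪⟫⁺ Cl? snd , ∈⟪⟫⁺ Cl? thd
                 , λ p∈ → within (∈⟪⟫⁻ Cl? p∈))
      where
      ⊆W : ∀ {p} → Cl p → p ∈ W
      ⊆W fst = x∈W
      ⊆W snd = y∈W
      ⊆W thd = z∈W
      ⊆W (add _ _ p∈W _ _ _) = p∈W
      within : ∀ {p} → Cl p → Z p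
      within fst = zx
      within snd = zy
      within thd = zz
      within (add cq cr w∈W q⇒r r⇒w w⇒q) = closed (within cq) (within cr) w∈W q⇒r r⇒w w⇒q
      isModule : (Cl? : Decidable Cl) → IsModule W ⟪ Cl? ⟫
      isModule Cl? = record
        { ⊆W = λ p∈ → ⊆W (∈⟪⟫⁻ Cl? p∈)
        ; hom = λ w∈W w∉ p∈ q∈ w⇒p →
            let w∉Cl = w∉ ∘ ∈⟪⟫⁺ Cl?
            in spread w∈W w∉Cl (gather w∈W w∉Cl (∈⟪⟫⁻ Cl? p∈) w⇒p) (∈⟪⟫⁻ Cl? q∈)
        }

  record T5 (f₀ f₁ f₂ f₃ f₄ : Fin n) : Set where
    constructor t5
    field
      e₀₁ : f₀ ⇒ f₁
      e₀₂ : f₀ ⇒ f₂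
      e₁₂ : f₁ ⇒ f₂
      e₁₃ : f₁ ⇒ f₃
      e₂₃ : f₂ ⇒ f₃
      e₂₄ : f₂ ⇒ f₄
      e₃₄ : f₃ ⇒ f₄
      e₃₀ : f₃ ⇒ f₀
      e₄₀ : f₄ ⇒ f₀
      e₄₁ : f₄ ⇒ f₁

  rotate : ∀ {a b c d e} → T5 a b c d e → T5 b c d e a
  rotate (t5 e₀₁ e₀₂ e₁₂ e₁₃ e₂₃ e₂₄ e₃₄ e₃₀ e₄₀ e₄₁) =
    t5 e₁₂ e₁₃ e₂₃ e₂₄ e₃₄ e₃₀ e₄₀ e₄₁ e₀₁ e₀₂

  -- The vertex that `w` can replace in a T₅ is not mentioned: `w` may dominate it, be dominated by
  -- it, or be equal to it.
  record Twin (f₁ f₂ f₃ f₄ w : Fin n) : Set where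
    constructor twin
    field
      o₁ : w ⇒ f₁
      o₂ : w ⇒ f₂
      i₃ : f₃ ⇒ w
      i₄ : f₄ ⇒ w

  self : ∀ {a b c d e} → T5 a b c d e → Twin b c d e a
  self F = twin (T5.e₀₁ F) (T5.e₀₂ F) (T5.e₃₀ F) (T5.e₄₀ F)

  twin? : ∀ b c d e → Decidable (Twin b c d e)
  twin? b c d e w with edge? w b ×-dec edge? w c ×-dec edge? d w ×-dec edge? e w
  ... | yes (o₁ , o₂ , i₃ , i₄) = yes (twin o₁ o₂ i₃ i₄)
  ... | no ¬t = no λ (twin o₁ o₂ i₃ i₄) → ¬t (o₁ , o₂ , i₃ , i₄)

  replace : ∀ {a b c d e w} → T5 a b c d e → Twin b c d e w → T5 w b c d e
  replace (t5 _ _ e₁₂ e₁₃ e₂₃ e₂₄ e₃₄ _ _ e₄₁) (twin o₁ o₂ i₃ i₄) =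
    t5 o₁ o₂ e₁₂ e₁₃ e₂₃ e₂₄ e₃₄ i₃ i₄ e₄₁

  Dominates : (a b c d e w : Fin n) → Set
  Dominates a b c d e w = w ⇒ a × w ⇒ b × w ⇒ c × w ⇒ d × w ⇒ e

  Dominated : (a b c d e w : Fin n) → Set
  Dominated a b c d e w = a ⇒ w × b ⇒ w × c ⇒ w × d ⇒ w × e ⇒ w

  dominates? : ∀ a b c d e → Decidable (Dominates a b c d e)
  dominates? a b c d e w = edge? w a ×-dec edge? w b ×-dec edge? w c ×-dec edge? w d ×-dec edge? w e

  dominated? : ∀ a b c d e → Decidable (Dominated a b c d e)
  dominated? a b c d e w = edge? a w ×-dec edge? b w ×-dec edge? c w ×-dec edge? d w ×-dec edge? e w

  data Class (a b c d e w : Fin n) : Set where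
    above : Dominates a b c d e w → Class a b c d e w
    below : Dominated a b c d e w → Class a b c d e w
    twin₀ : Twin b c d e w → Class a b c d e w
    twin₁ : Twin c d e a w → Class a b c d e w
    twin₂ : Twin d e a b w → Class a b c d e w
    twin₃ : Twin e a b c w → Class a b c d e w
    twin₄ : Twin a b c d w → Class a b c d e w

  module _ (u5-free : NoU5) where

    module _ {a b c d e w : Fin n} where

      -- `w`, `e`, `a`, `b`, `c` would be the vertices v₁ to v₅ of U₅.
      oneOut : T5 a b c d e → w ⇒ a → b ⇒ w → c ⇒ w → e ⇒ w → ⊥
      oneOut (t5 e₀₁ e₀₂ e₁₂ e₁₃ e₂₃ e₂₄ e₃₄ e₃₀ e₄₀ e₄₁) wa bw cw ew =
        u5-free ew wa e₄₀ e₄₁ e₀₁ e₀₂ e₁₂ bw cw e₂₄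

      -- `b`, `w`, `d`, `e`, `a` would be the vertices v₁ to v₅ of U₅.
      oneIn : T5 a b c d e → a ⇒ w → w ⇒ b → w ⇒ d → w ⇒ e → ⊥
      oneIn (t5 e₀₁ e₀₂ e₁₂ e₁₃ e₂₃ e₂₄ e₃₄ e₃₀ e₄₀ e₄₁) aw wb wd we =
        u5-free wb e₁₃ wd we e₃₄ e₃₀ e₄₀ e₄₁ e₀₁ aw

    -- Between `a` and `b` the relation of `w` to the cycle turns from in to out. Of the patterns on
    -- `c`, `d`, `e`, all but the two twin patterns fall under `oneOut` or `oneIn` in some rotation.
    startOf : ∀ {a b c d e w} → T5 a b c d e → a ⇒ w → w ⇒ b → Twin b c d e w ⊎ Twin c d e a w
    startOf {a} {b} {c} {d} {e} {w} F aw wb with compare w c | compare w d | compare w e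
    ... | inj₁ refl | _ | _ = ⊥-elim (asym wb (T5.e₁₂ F))
    ... | _ | inj₁ refl | _ = ⊥-elim (asym wb (T5.e₁₃ F))
    ... | _ | _ | inj₁ refl = ⊥-elim (asym aw (T5.e₄₀ F))
    ... | _ | inj₂ (inj₁ wd) | inj₂ (inj₁ we) = ⊥-elim (oneIn F aw wb wd we)
    ... | inj₂ (inj₂ cw) | inj₂ (inj₂ dw) | _ = ⊥-elim (oneOut (rotate F) wb cw dw aw)
    ... | inj₂ (inj₁ wc) | inj₂ (inj₁ wd) | inj₂ (inj₂ ew) = inj₂ (twin wc wd ew aw)
    ... | inj₂ (inj₁ wc) | inj₂ (inj₂ dw) | inj₂ (inj₂ ew) = inj₁ (twin wb wc dw ew)
    ... | inj₂ (inj₁ wc) | inj₂ (inj₂ dw) | inj₂ (inj₁ we) =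
      ⊥-elim (oneIn (rotate (rotate (rotate F))) dw we wb wc)
    ... | inj₂ (inj₂ cw) | inj₂ (inj₁ wd) | inj₂ (inj₂ ew) =
      ⊥-elim (oneOut (rotate (rotate (rotate F))) wd ew aw cw)

    -- A vertex outside the T₅ that neither dominates it nor is dominated by it has a turn from in
    -- to out somewhere along the cycle, and `startOf` applies there.
    classify : ∀ {a b c d e} → T5 a b c d e → ∀ w → Class a b c d e w
    classify {a} {b} {c} {d} {e} F w
      with compare w a | compare w b | compare w c | compare w d | compare w e
    ... | inj₁ refl | _ | _ | _ | _ = twin₀ (self F)
    ... | _ | inj₁ refl | _ | _ | _ = twin₁ (self (rotate F))
    ... | _ | _ | inj₁ refl | _ | _ = twin₂ (self (rotate (rotate F)))
    ... | _ | _ | _ | inj₁ refl | _ = twin₃ (self (rotate (rotate (rotate F))))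
    ... | _ | _ | _ | _ | inj₁ refl = twin₄ (self (rotate (rotate (rotate (rotate F)))))
    ... | inj₂ (inj₂ aw) | inj₂ (inj₁ wb) | _ | _ | _ = [ twin₀ , twin₁ ]′ (startOf F aw wb)
    ... | _ | inj₂ (inj₂ bw) | inj₂ (inj₁ wc) | _ | _ = [ twin₁ , twin₂ ]′ (startOf (rotate F) bw wc)
    ... | _ | _ | inj₂ (inj₂ cw) | inj₂ (inj₁ wd) | _ =
      [ twin₂ , twin₃ ]′ (startOf (rotate (rotate F)) cw wd)
    ... | _ | _ | _ | inj₂ (inj₂ dw) | inj₂ (inj₁ we) =
      [ twin₃ , twin₄ ]′ (startOf (rotate (rotate (rotate F))) dw we)
    ... | inj₂ (inj₁ wa) | _ | _ | _ | inj₂ (inj₂ ew) =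
      [ twin₄ , twin₀ ]′ (startOf (rotate (rotate (rotate (rotate F)))) ew wa)
    ... | inj₂ (inj₁ wa) | inj₂ (inj₁ wb) | inj₂ (inj₁ wc) | inj₂ (inj₁ wd) | inj₂ (inj₁ we) =
      above (wa , wb , wc , wd , we)
    ... | inj₂ (inj₂ aw) | inj₂ (inj₂ bw) | inj₂ (inj₂ cw) | inj₂ (inj₂ dw) | inj₂ (inj₂ ew) =
      below (aw , bw , cw , dw , ew)

    -- With `a` replaced by `x`, an edge from `y` to `x` would be the pattern of `oneIn`. Thus the
    -- edges between consecutive twin classes all run as in the T₅.
    twin₀→twin₁ : ∀ {a b c d e x y} → T5 a b c d e → Twin b c d e x → Twin c d e a y → x ⇒ y
    twin₀→twin₁ {x = x} {y = y} F X@(twin _ _ dx _) Y@(twin yc yd ey _) with compare x y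
    ... | inj₁ refl = ⊥-elim (asym dx yd)
    ... | inj₂ (inj₁ x⇒y) = x⇒y
    ... | inj₂ (inj₂ y⇒x) =
      ⊥-elim (oneIn (rotate (rotate (rotate (rotate (replace F X))))) ey y⇒x yc yd)

    dominates-twin : ∀ {a b c d e x y} → T5 a b c d e → Twin b c d e x → Dominates a b c d e y → y ⇒ x
    dominates-twin {x = x} {y = y} F X@(twin _ _ dx _) (_ , yb , yc , yd , ye) with compare y x
    ... | inj₁ refl = ⊥-elim (asym dx yd)
    ... | inj₂ (inj₁ y⇒x) = y⇒x
    ... | inj₂ (inj₂ x⇒y) = ⊥-elim (oneIn (replace F X) x⇒y yb yd ye)

    dominated-twin : ∀ {a b c d e x y} → T5 a b c d e → Twin b c d e x → Dominated a b c d e y → x ⇒ y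
    dominated-twin {x = x} {y = y} F X@(twin xb _ _ _) (_ , by , cy , dy , ey) with compare y x
    ... | inj₁ refl = ⊥-elim (asym by xb)
    ... | inj₂ (inj₁ y⇒x) = ⊥-elim (oneOut (replace F X) y⇒x by cy ey)
    ... | inj₂ (inj₂ x⇒y) = x⇒y

    -- The only vertices outside the twin class that are not forced to agree on x and x′ are
    -- opposite to it: dominated by b, c and dominating d, e.
    unsplit : ∀ {a b c d e x x′ y} → T5 a b c d e → Twin b c d e x → Twin b c d e x′ →
      ¬ Twin b c d e y → x′ ⇒ x → x′ ⇒ y → y ⇒ x → ⊥
    unsplit {b = b} {c} {d} {e} {x} {x′} {y} F X@(twin xb xc dx ex) X′@(twin x′b _ dx′ _) y∉ x′⇒x x′⇒y y⇒x
      with classify (replace F X′) y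
    ... | above (y⇒x′ , _) = asym x′⇒y y⇒x′
    ... | below (_ , by , cy , dy , ey) = oneOut (replace F X) y⇒x by cy ey
    ... | twin₀ Y = y∉ Y
    ... | twin₁ Y = asym y⇒x (twin₀→twin₁ (replace F X′) X Y)
    ... | twin₃ (twin _ y⇒x′ _ _) = asym x′⇒y y⇒x′
    ... | twin₄ (twin y⇒x′ _ _ _) = asym x′⇒y y⇒x′
    ... | twin₂ (twin yd ye _ by) with compare y c
    ...   | inj₁ refl = asym y⇒x xc
    ...   | inj₂ (inj₁ yc) = oneIn (rotate (replace F X)) by yc ye y⇒x
    -- `x`, `x′`, `b`, `y`, `d` are v₁ to v₅ of U₅.
    ...   | inj₂ (inj₂ cy) = u5-free x′⇒x xb x′b x′⇒y by (T5.e₁₃ F) yd y⇒x dx dx′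

    module _ {W : Subset n} (prime : Prime W) where

      -- By `unsplit`, going once round a cyclic triangle of twins shows that no vertex outside the
      -- twin class distinguishes the three. The closure therefore consists of twins, and the module
      -- it yields omits `b`, against primality.
      twinTriangle : ∀ {a b c d e p q r} → T5 a b c d e → b ∈ W → p ∈ W → q ∈ W → r ∈ W →
        Twin b c d e p → Twin b c d e q → Twin b c d e r → p ⇒ q → q ⇒ r → r ⇒ p → ⊥
      twinTriangle {a} {b} {c} {d} {e} {p} {q} {r} F b∈W p∈W q∈W r∈W P Q R p⇒q q⇒r r⇒p =
        closureModule p⇒q q⇒r r⇒p p∈W q∈W r∈W zp zq zr closed λ (M , isM , p∈M , q∈M , _ , M⊆Z) →
          loopless G b (Twin.o₁ (proj₁ (M⊆Z (prime isM p∈M q∈M p≢q b∈W))))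
        where
        p≢q : p ≢ q
        p≢q refl = loopless G p p⇒q
        Z : Pred (Fin n) 0ℓ
        Z x = Twin b c d e x × (∀ {y} → ¬ Twin b c d e y → (y ⇒ p → y ⇒ x) × (y ⇒ x → y ⇒ p))
        back : ∀ {u w y} → Twin b c d e u → Twin b c d e w → ¬ Twin b c d e y → w ⇒ u → y ⇒ u → y ⇒ w
        back {w = w} {y = y} U W′ y∉ w⇒u y⇒u with compare y w
        ... | inj₁ refl = contradiction W′ y∉
        ... | inj₂ (inj₁ y⇒w) = y⇒w
        ... | inj₂ (inj₂ w⇒y) = ⊥-elim (unsplit F U W′ y∉ w⇒u w⇒y y⇒u)
        zp : Z p
        zp = P , λ _ → (λ y⇒p → y⇒p) , (λ y⇒p → y⇒p)
        zr : Z r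
        zr = R , λ y∉ → back P R y∉ r⇒p , λ y⇒r → back Q P y∉ p⇒q (back R Q y∉ q⇒r y⇒r)
        zq : Z q
        zq = Q , λ y∉ → (λ y⇒p → back R Q y∉ q⇒r (back P R y∉ r⇒p y⇒p)) , back Q P y∉ p⇒q
        closed : ∀ {q r w} → Z q → Z r → w ∈ W → q ⇒ r → r ⇒ w → w ⇒ q → Z w
        closed {q} {r} {w} (Q , hq) (R , hr) w∈W q⇒r r⇒w w⇒q with twin? b c d e w
        ... | no w∉ = ⊥-elim (asym r⇒w (proj₁ (hr w∉) (proj₂ (hq w∉) w⇒q)))
        ... | yes w∈ = w∈ , λ y∉ →
          (λ y⇒p → back Q w∈ y∉ w⇒q (proj₁ (hq y∉) y⇒p))
          , λ y⇒w → proj₂ (hr y∉) (back w∈ R y∉ r⇒w y⇒w)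

      module _ {a b c d e} (F : T5 a b c d e) (a∈W : a ∈ W) (b∈W : b ∈ W) where

        private
          Mixed : Pred (Fin n) 0ℓ
          Mixed x = x ∈ W × ¬ Dominates a b c d e x × ¬ Dominated a b c d e x

          mixed? : Decidable Mixed
          mixed? x = (x ∈? W) ×-dec (¬? (dominates? a b c d e x) ×-dec ¬? (dominated? a b c d e x))

          agree : ∀ {y} → ¬ Mixed y → y ∈ W →
            (∀ {x} → Mixed x → y ⇒ x) ⊎ (∀ {x} → Mixed x → x ⇒ y)
          agree {y} y∉ y∈W with dominates? a b c d e y | dominated? a b c d e y
          ... | no ¬o | no ¬i = contradiction (y∈W , ¬o , ¬i) y∉
          ... | yes o@(ya , yb , yc , yd , ye) | _ = inj₁ λ {x} (_ , ¬o , ¬i) → toTwin x ¬o ¬i (classify F x)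
            where
            toTwin : ∀ x → ¬ Dominates a b c d e x → ¬ Dominated a b c d e x → Class a b c d e x → y ⇒ x
            toTwin x ¬o ¬i (above h) = contradiction h ¬o
            toTwin x ¬o ¬i (below h) = contradiction h ¬i
            toTwin x _ _ (twin₀ X) = dominates-twin F X o
            toTwin x _ _ (twin₁ X) = dominates-twin (rotate F) X (yb , yc , yd , ye , ya)
            toTwin x _ _ (twin₂ X) = dominates-twin (rotate (rotate F)) X (yc , yd , ye , ya , yb)
            toTwin x _ _ (twin₃ X) = dominates-twin (rotate (rotate (rotate F))) X (yd , ye , ya , yb , yc)
            toTwin x _ _ (twin₄ X) =
              dominates-twin (rotate (rotate (rotate (rotate F)))) X (ye , ya , yb , yc , yd)
          ... | no _ | yes o@(ya , yb , yc , yd , ye) = inj₂ λ {x} (_ , ¬o , ¬i) → toTwin x ¬o ¬i (classify F x)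
            where
            toTwin : ∀ x → ¬ Dominates a b c d e x → ¬ Dominated a b c d e x → Class a b c d e x → x ⇒ y
            toTwin x ¬o ¬i (above h) = contradiction h ¬o
            toTwin x ¬o ¬i (below h) = contradiction h ¬i
            toTwin x _ _ (twin₀ X) = dominated-twin F X o
            toTwin x _ _ (twin₁ X) = dominated-twin (rotate F) X (yb , yc , yd , ye , ya)
            toTwin x _ _ (twin₂ X) = dominated-twin (rotate (rotate F)) X (yc , yd , ye , ya , yb)
            toTwin x _ _ (twin₃ X) = dominated-twin (rotate (rotate (rotate F))) X (yd , ye , ya , yb , yc)
            toTwin x _ _ (twin₄ X) =
              dominated-twin (rotate (rotate (rotate (rotate F)))) X (ye , ya , yb , yc , yd)

          mixedModule : IsModule W ⟪ mixed? ⟫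
          mixedModule = record
            { ⊆W = λ x∈ → proj₁ (∈⟪⟫⁻ mixed? x∈)
            ; hom = hom
            }
            where
            hom : ∀ {x p q} → x ∈ W → x ∉ ⟪ mixed? ⟫ → p ∈ ⟪ mixed? ⟫ → q ∈ ⟪ mixed? ⟫ → x ⇒ p → x ⇒ q
            hom x∈W x∉ p∈ q∈ x⇒p with agree (x∉ ∘ ∈⟪⟫⁺ mixed?) x∈W
            ... | inj₁ out = out (∈⟪⟫⁻ mixed? q∈)
            ... | inj₂ inn = ⊥-elim (asym x⇒p (inn (∈⟪⟫⁻ mixed? p∈)))

        -- The remaining, mixed vertices are twins of vertices of the T₅, so a vertex that dominates
        -- the T₅ or is dominated by it has the same relation to all of them. They form a module
        -- containing `a` and `b`, which must be all of `W`.
        noHom : ∀ {x} → x ∈ W → ¬ Dominates a b c d e x × ¬ Dominated a b c d e x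
        noHom x∈W = proj₂ (∈⟪⟫⁻ mixed? (prime mixedModule a∈ b∈ a≢b x∈W))
          where
          a∈ : a ∈ ⟪ mixed? ⟫
          a∈ = ∈⟪⟫⁺ mixed? (a∈W , loopless G a ∘ proj₁ , loopless G a ∘ proj₁)
          b∈ : b ∈ ⟪ mixed? ⟫
          b∈ = ∈⟪⟫⁺ mixed? (b∈W , loopless G b ∘ proj₁ ∘ proj₂ , loopless G b ∘ proj₁ ∘ proj₂)
          a≢b : a ≢ b
          a≢b refl = loopless G a (T5.e₀₁ F)

      module _ {v b c d e} (F : T5 v b c d e) (v∈W : v ∈ W) (b∈W : b ∈ W) (c∈W : c ∈ W) (d∈W : d ∈ W) where

        private
          data Layer (p : Fin n) : ℕ → Set where
            layer₀ : v ⇒ p → Twin b c d e p → Layer p 0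
            layer₁ : Twin c d e v p → Layer p 1
            layer₂ : Twin d e v b p → Layer p 2

          layer : ∀ {p} → p ∈ W → v ⇒ p → Σ ℕ (Layer p)
          layer {p} p∈W v⇒p with classify F p
          ... | above h = contradiction h (proj₁ (noHom F v∈W b∈W p∈W))
          ... | below h = contradiction h (proj₂ (noHom F v∈W b∈W p∈W))
          ... | twin₀ P = 0 , layer₀ v⇒p P
          ... | twin₁ P = 1 , layer₁ P
          ... | twin₂ P = 2 , layer₂ P
          ... | twin₃ (twin _ p⇒v _ _) = ⊥-elim (asym v⇒p p⇒v)
          ... | twin₄ (twin p⇒v _ _ _) = ⊥-elim (asym v⇒p p⇒v)

          monotone : ∀ {p q i j} → Layer p i → Layer q j → p ⇒ q → i ≤ j
          monotone (layer₀ _ _) _ _ = z≤n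
          monotone (layer₁ P) (layer₀ _ Q) p⇒q = ⊥-elim (asym p⇒q (twin₀→twin₁ F Q P))
          monotone (layer₁ _) (layer₁ _) _ = s≤s z≤n
          monotone (layer₁ _) (layer₂ _) _ = s≤s z≤n
          -- With `p` in place of `c`, the T₅ read from `b` ends in `v`, and `v ⇒ q` is the last
          -- edge that `oneOut` asks for; hence `layer₀` records it.
          monotone (layer₂ P) (layer₀ v⇒q (twin qb _ dq _)) p⇒q =
            ⊥-elim (oneOut (rotate (rotate (rotate (rotate (replace (rotate (rotate F)) P))))) qb p⇒q dq v⇒q)
          monotone (layer₂ P) (layer₁ Q) p⇒q = ⊥-elim (asym p⇒q (twin₀→twin₁ (rotate F) Q P))
          monotone (layer₂ _) (layer₂ _) _ = s≤s (s≤s z≤n)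

        -- The out-neighbours of `v` are twins of `v`, `b` or `c`, and no edge leads from a later of
        -- these layers to an earlier one. A cyclic triangle would lie in one layer, against
        -- `twinTriangle`.
        outAcyclic : ∀ {p q r} → p ∈ W → q ∈ W → r ∈ W → v ⇒ p → v ⇒ q → v ⇒ r → p ⇒ q → q ⇒ r → r ⇒ p → ⊥
        outAcyclic p∈W q∈W r∈W v⇒p v⇒q v⇒r p⇒q q⇒r r⇒p
          with layer p∈W v⇒p | layer q∈W v⇒q | layer r∈W v⇒r
        ... | _ , P | _ , Q | _ , R with monotone P Q p⇒q | monotone Q R q⇒r | monotone R P r⇒p
        ...   | i≤j | j≤k | k≤i with refl ← ≤-antisym i≤j (≤-trans j≤k k≤i)
                                 with refl ← ≤-antisym j≤k k≤i with P | Q | R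
        ...     | layer₀ _ P | layer₀ _ Q | layer₀ _ R = twinTriangle F b∈W p∈W q∈W r∈W P Q R p⇒q q⇒r r⇒p
        ...     | layer₁ P | layer₁ Q | layer₁ R = twinTriangle (rotate F) c∈W p∈W q∈W r∈W P Q R p⇒q q⇒r r⇒p
        ...     | layer₂ P | layer₂ Q | layer₂ R =
          twinTriangle (rotate (rotate F)) d∈W p∈W q∈W r∈W P Q R p⇒q q⇒r r⇒p

-- Covering a T₅-free tournament by two transitive sets

argmax : ∀ {n} {P : Pred (Fin n) 0ℓ} → Decidable P → (f : Fin n → ℕ) → ∃ P →
  Σ (Fin n) λ x → P x × (∀ {y} → P y → f y ≤ f x)
argmax {suc n} {P} P? f (w , pw) with Fin.any? (P? ∘ suc)
... | no none = zero , p₀ w pw , λ {y} → least y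
  where
  p₀ : ∀ w → P w → P zero
  p₀ zero pw = pw
  p₀ (suc w) pw = contradiction (w , pw) none
  least : ∀ y → P y → f y ≤ f zero
  least zero _ = ≤-refl
  least (suc y) py = contradiction (y , py) none
... | yes some with argmax (P? ∘ suc) (f ∘ suc) some
...   | x , px , max with P? zero | ≤-total (f (suc x)) (f zero)
...     | yes p₀ | inj₁ le = zero , p₀ , λ {y} → best y
  where
  best : ∀ y → P y → f y ≤ f zero
  best zero _ = ≤-refl
  best (suc y) py = ≤-trans (max py) le
...     | yes p₀ | inj₂ ge = suc x , px , λ {y} → best y
  where
  best : ∀ y → P y → f y ≤ f (suc x)
  best zero _ = ge
  best (suc y) py = max py
...     | no ¬p₀ | _ = suc x , px , λ {y} → best y
  where
  best : ∀ y → P y → f y ≤ f (suc x)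
  best zero p₀ = contradiction p₀ ¬p₀
  best (suc y) py = max py

module _ {n : ℕ} (G : Tournament n) where

  private
    _⇒_ = _⟶_ G

  layeredAcyclic : {L : Fin n → ℕ → Set} →
    (∀ {p q i j} → L p i → L q j → p ⇒ q → i ≤ j) →
    (∀ {p q r i} → L p i → L q i → L r i → p ⇒ q → q ⇒ r → r ⇒ p → ⊥) →
    ∀ {p q r i j k} → L p i → L q j → L r k → p ⇒ q → q ⇒ r → r ⇒ p → ⊥
  layeredAcyclic mono flat P Q R p⇒q q⇒r r⇒p
    with mono P Q p⇒q | mono Q R q⇒r | mono R P r⇒p
  ... | i≤j | j≤k | k≤i with refl ← ≤-antisym i≤j (≤-trans j≤k k≤i)
                           with refl ← ≤-antisym j≤k k≤i = flat P Q R p⇒q q⇒r r⇒p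

  isModule? : ∀ W → Decidable (IsModule G W)
  isModule? W M = mapDec
    (λ (⊆W , hom) → record { ⊆W = λ {x} → ⊆W {x} ; hom = λ x∈ x∉ p∈ q∈ → hom _ _ _ x∈ x∉ p∈ q∈ })
    (λ isM → (λ {x} → IsModule.⊆W isM {x}) , λ _ _ _ x∈ x∉ p∈ q∈ → IsModule.hom isM x∈ x∉ p∈ q∈)
    ((M ⊆? W) ×-dec Fin.all? λ x → Fin.all? λ p → Fin.all? λ q →
      (x ∈? W) →-dec ¬? (x ∈? M) →-dec (p ∈? M) →-dec (q ∈? M) →-dec edge? G x p →-dec edge? G x q)

  record Cover (W : Subset n) (v : Fin n) : Set where
    field
      P Q : Subset n
      P⊆W : P ⊆ W
      Q⊆W : Q ⊆ W
      v∈P : v ∈ P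
      v∈Q : v ∈ Q
      cover : ∀ {x} → x ∈ W → x ∈ P ⊎ x ∈ Q
      acyclicP : Acyclic G P
      acyclicQ : Acyclic G Q

  -- `linked` carries the induction: the cover of a smaller set around another vertex must
  -- distribute the cyclic triangles through that vertex in a known way.
  record LinkedCover (W : Subset n) (v : Fin n) : Set where
    field
      base : Cover W v
    open Cover base public
    field
      linked : ∀ {a b} → a ∈ W → b ∈ W → v ⇒ a → a ⇒ b → b ⇒ v → a ∈ P × b ∈ Q

  NoT5 : Subset n → Set
  NoT5 W = ∀ {a b c d e} → a ∈ W → b ∈ W → c ∈ W → d ∈ W → e ∈ W → ¬ T5 G a b c d e

  -- A weakening of primality that passes to every set met in the induction: a module, its
  -- contraction, and an out-neighbourhood with one added vertex.
  Tame : Subset n → Fin n → Set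
  Tame W v = ∀ {M} → IsModule G W M → v ∉ M → Acyclic G M

  module _ {W M : Subset n} {v : Fin n} (isM : IsModule G W M) (v∈M : v ∈ M) where
    open IsModule isM

    private
      Rest? : Decidable (λ x → x ∈ W × (x ∉ M ⊎ x ≡ v))
      Rest? x = (x ∈? W) ×-dec (¬? (x ∈? M) ⊎-dec (x Fin.≟ v))

    -- `W` with `M` contracted to its vertex `v`.
    rest : Subset n
    rest = ⟪ Rest? ⟫

    rest⊆W : rest ⊆ W
    rest⊆W x∈ = proj₁ (∈⟪⟫⁻ Rest? x∈)

    v∈rest : v ∈ rest
    v∈rest = ∈⟪⟫⁺ Rest? (⊆W v∈M , inj₂ refl)

    ∈rest : ∀ {x} → x ∈ W → x ∉ M → x ∈ rest
    ∈rest x∈W x∉M = ∈⟪⟫⁺ Rest? (x∈W , inj₁ x∉M)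

    rest∩M : ∀ {x} → x ∈ rest → x ∈ M → x ≡ v
    rest∩M x∈ x∈M with proj₂ (∈⟪⟫⁻ Rest? x∈)
    ... | inj₁ x∉M = contradiction x∈M x∉M
    ... | inj₂ x≡v = x≡v

    tame-M : Tame W v → Tame M v
    tame-M tame {N} isN v∉N = tame record
      { ⊆W = ⊆W ∘ IsModule.⊆W isN
      ; hom = hom-N
      } v∉N
      where
      hom-N : ∀ {x p q} → x ∈ W → x ∉ N → p ∈ N → q ∈ N → x ⇒ p → x ⇒ q
      hom-N {x} x∈W x∉N p∈N q∈N with x ∈? M
      ... | yes x∈M = IsModule.hom isN x∈M x∉N p∈N q∈N
      ... | no x∉M = hom x∈W x∉M (IsModule.⊆W isN p∈N) (IsModule.⊆W isN q∈N)

    tame-rest : Tame W v → Tame rest v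
    tame-rest tame {N} isN v∉N = tame record
      { ⊆W = rest⊆W ∘ IsModule.⊆W isN
      ; hom = hom-N
      } v∉N
      where
      out : ∀ {p} → p ∈ N → p ∈ W × p ∉ M
      out p∈N = rest⊆W (IsModule.⊆W isN p∈N)
              , λ p∈M → v∉N (subst (_∈ N) (rest∩M (IsModule.⊆W isN p∈N) p∈M) p∈N)
      hom-N : ∀ {x p q} → x ∈ W → x ∉ N → p ∈ N → q ∈ N → x ⇒ p → x ⇒ q
      hom-N {x} x∈W x∉N p∈N q∈N x⇒p with x ∈? M
      ... | no x∉M = IsModule.hom isN (∈rest x∈W x∉M) x∉N p∈N q∈N x⇒p
      ... | yes x∈M with out p∈N | out q∈N
      -- Vertices outside `M` do not distinguish `x` from `v`, and `v` belongs to `rest`, where `N`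
      -- is a module.
      ...   | p∈W , p∉M | q∈W , q∉M = hom′ q∈W q∉M v∈M x∈M
        (IsModule.hom isN v∈rest v∉N p∈N q∈N (hom′ p∈W p∉M x∈M v∈M x⇒p))

    -- A cyclic triangle cannot meet a module in exactly two vertices. If it meets `M` in one,
    -- replacing that vertex by `v` gives a triangle in `T₂`; otherwise it lies wholly in `T₁` or in
    -- `T₂`.
    acyclic-glue : ∀ {T T₁ T₂} → T ⊆ W → (∀ {x} → x ∈ T → x ∈ M → x ∈ T₁ × v ∈ T₂) →
      (∀ {x} → x ∈ T → x ∉ M → x ∈ T₂) → Acyclic G T₁ → Acyclic G T₂ → Acyclic G T
    acyclic-glue {T} T⊆W in₁ in₂ acyclic₁ acyclic₂ {x} {y} {z} x∈ y∈ z∈ x⇒y y⇒z z⇒x =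
      cases (x ∈? M) (y ∈? M) (z ∈? M)
      where
      two : ∀ {x y z} → x ∈ M → y ∈ M → z ∈ T → z ∉ M → y ⇒ z → z ⇒ x → ⊥
      two x∈M y∈M z∈ z∉M y⇒z z⇒x = asym G y⇒z (hom (T⊆W z∈) z∉M x∈M y∈M z⇒x)
      one : ∀ {x y z} → x ∈ T → x ∈ M → y ∈ T → y ∉ M → z ∈ T → z ∉ M → x ⇒ y → y ⇒ z → z ⇒ x → ⊥
      one x∈ x∈M y∈ y∉M z∈ z∉M x⇒y y⇒z z⇒x = acyclic₂ (proj₂ (in₁ x∈ x∈M)) (in₂ y∈ y∉M) (in₂ z∈ z∉M)
        (hom′ (T⊆W y∈) y∉M x∈M v∈M x⇒y) y⇒z (hom (T⊆W z∈) z∉M x∈M v∈M z⇒x)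
      cases : Dec (x ∈ M) → Dec (y ∈ M) → Dec (z ∈ M) → ⊥
      cases (yes x∈M) (yes y∈M) (yes z∈M) =
        acyclic₁ (proj₁ (in₁ x∈ x∈M)) (proj₁ (in₁ y∈ y∈M)) (proj₁ (in₁ z∈ z∈M)) x⇒y y⇒z z⇒x
      cases (yes x∈M) (yes y∈M) (no z∉M) = two x∈M y∈M z∈ z∉M y⇒z z⇒x
      cases (no x∉M) (yes y∈M) (yes z∈M) = two y∈M z∈M x∈ x∉M z⇒x x⇒y
      cases (yes x∈M) (no y∉M) (yes z∈M) = two z∈M x∈M y∈ y∉M x⇒y y⇒z
      cases (yes x∈M) (no y∉M) (no z∉M) = one x∈ x∈M y∈ y∉M z∈ z∉M x⇒y y⇒z z⇒x
      cases (no x∉M) (yes y∈M) (no z∉M) = one y∈ y∈M z∈ z∉M x∈ x∉M y⇒z z⇒x x⇒y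
      cases (no x∉M) (no y∉M) (yes z∈M) = one z∈ z∈M x∈ x∉M y∈ y∉M z⇒x x⇒y y⇒z
      cases (no x∉M) (no y∉M) (no z∉M) = acyclic₂ (in₂ x∈ x∉M) (in₂ y∈ y∉M) (in₂ z∈ z∉M) x⇒y y⇒z z⇒x

    -- No cyclic triangle on `v`, `a`, `b` has just one of `a` and `b` in `M`, so `linked` is
    -- inherited from the two covers.
    glue : LinkedCover M v → LinkedCover rest v → LinkedCover W v
    glue C₁ C₂ = record
      { base = record
        { P = C₁.P ∪ C₂.P
        ; Q = C₁.Q ∪ C₂.Q
        ; P⊆W = ∪⊆W C₁.P⊆W C₂.P⊆W
        ; Q⊆W = ∪⊆W C₁.Q⊆W C₂.Q⊆W
        ; v∈P = x∈p∪q⁺ (inj₁ C₁.v∈P)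
        ; v∈Q = x∈p∪q⁺ (inj₁ C₁.v∈Q)
        ; cover = covered
        ; acyclicP = acyclic-∪ C₁.P⊆W C₂.P⊆W C₁.v∈P C₂.v∈P C₁.acyclicP C₂.acyclicP
        ; acyclicQ = acyclic-∪ C₁.Q⊆W C₂.Q⊆W C₁.v∈Q C₂.v∈Q C₁.acyclicQ C₂.acyclicQ
        }
      ; linked = link
      }
      where
      module C₁ = LinkedCover C₁
      module C₂ = LinkedCover C₂
      ∪⊆W : ∀ {T₁ T₂} → T₁ ⊆ M → T₂ ⊆ rest → T₁ ∪ T₂ ⊆ W
      ∪⊆W {T₁} {T₂} T₁⊆M T₂⊆rest x∈ = [ ⊆W ∘ T₁⊆M , rest⊆W ∘ T₂⊆rest ]′ (x∈p∪q⁻ T₁ T₂ x∈)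
      acyclic-∪ : ∀ {T₁ T₂} → T₁ ⊆ M → T₂ ⊆ rest → v ∈ T₁ → v ∈ T₂ → Acyclic G T₁ → Acyclic G T₂ →
        Acyclic G (T₁ ∪ T₂)
      acyclic-∪ {T₁} {T₂} T₁⊆M T₂⊆rest v∈T₁ v∈T₂ = acyclic-glue (∪⊆W T₁⊆M T₂⊆rest) in₁ in₂
        where
        in₁ : ∀ {x} → x ∈ T₁ ∪ T₂ → x ∈ M → x ∈ T₁ × v ∈ T₂
        in₁ x∈ x∈M with x∈p∪q⁻ T₁ T₂ x∈
        ... | inj₁ x∈₁ = x∈₁ , v∈T₂
        ... | inj₂ x∈₂ = subst (_∈ T₁) (sym (rest∩M (T₂⊆rest x∈₂) x∈M)) v∈T₁ , v∈T₂
        in₂ : ∀ {x} → x ∈ T₁ ∪ T₂ → x ∉ M → x ∈ T₂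
        in₂ x∈ x∉M with x∈p∪q⁻ T₁ T₂ x∈
        ... | inj₁ x∈₁ = contradiction (T₁⊆M x∈₁) x∉M
        ... | inj₂ x∈₂ = x∈₂
      covered : ∀ {x} → x ∈ W → x ∈ C₁.P ∪ C₂.P ⊎ x ∈ C₁.Q ∪ C₂.Q
      covered {x} x∈W with x ∈? M
      ... | yes x∈M = [ (λ h → inj₁ (x∈p∪q⁺ (inj₁ h))) , (λ h → inj₂ (x∈p∪q⁺ (inj₁ h))) ]′ (C₁.cover x∈M)
      ... | no x∉M = [ (λ h → inj₁ (x∈p∪q⁺ (inj₂ h))) , (λ h → inj₂ (x∈p∪q⁺ (inj₂ h))) ]′ (C₂.cover (∈rest x∈W x∉M))
      link : ∀ {a b} → a ∈ W → b ∈ W → v ⇒ a → a ⇒ b → b ⇒ v → a ∈ C₁.P ∪ C₂.P × b ∈ C₁.Q ∪ C₂.Q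
      link {a} {b} a∈W b∈W v⇒a a⇒b b⇒v with a ∈? M | b ∈? M
      ... | yes a∈M | yes b∈M = let (p , q) = C₁.linked a∈M b∈M v⇒a a⇒b b⇒v
                                in x∈p∪q⁺ (inj₁ p) , x∈p∪q⁺ (inj₁ q)
      ... | yes a∈M | no b∉M = ⊥-elim (asym G a⇒b (hom b∈W b∉M v∈M a∈M b⇒v))
      ... | no a∉M | yes b∈M = ⊥-elim (asym G a⇒b (hom′ a∈W a∉M v∈M b∈M v⇒a))
      ... | no a∉M | no b∉M = let (p , q) = C₂.linked (∈rest a∈W a∉M) (∈rest b∈W b∉M) v⇒a a⇒b b⇒v
                              in x∈p∪q⁺ (inj₂ p) , x∈p∪q⁺ (inj₂ q)

  -- `outer` lets `A₁` follow any set of in-neighbours of `v` within an acyclic set, while `inner`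
  -- keeps the cyclic triangles through `v` in `A₀`.
  record OutSplit (W : Subset n) (v : Fin n) : Set where
    field
      A₀ A₁ : Subset n
      A₀⊆ : ∀ {x} → x ∈ A₀ → x ∈ W × v ⇒ x
      A₁⊆ : ∀ {x} → x ∈ A₁ → x ∈ W × v ⇒ x
      split : ∀ {x} → x ∈ W → v ⇒ x → x ∈ A₀ ⊎ x ∈ A₁
      acyclic₀ : Acyclic G A₀
      acyclic₁ : Acyclic G A₁
      inner : ∀ {a b} → a ∈ W → b ∈ W → v ⇒ a → a ⇒ b → b ⇒ v → a ∈ A₀
      outer : ∀ {a b} → a ∈ A₁ → b ∈ W → b ⇒ v → b ⇒ a

  module _ (u5-free : NoU5 G) {W : Subset n} {v : Fin n} (t5-free : NoT5 W) (v∈W : v ∈ W)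
    (tame : Tame W v)
    (noModule : ∀ {M} → IsModule G W M → v ∈ M → ∀ {y} → y ∈ M → y ≢ v → W ⊆ M) where

    private

      -- Each of `v`, `a`, `b` dominates `c` and is dominated by `d`. A vertex that completes a
      -- triangle but lacks this property would give T₅ or U₅, so the property spreads over the
      -- closure, and the resulting module contains `v` and `a` but not `c`.
      noNested : ∀ {a b c d} → a ∈ W → b ∈ W → c ∈ W → d ∈ W → v ⇒ a → a ⇒ b → b ⇒ v →
        v ⇒ c → c ⇒ d → d ⇒ v → a ⇒ c → b ⇒ c → d ⇒ a → d ⇒ b → ⊥
      noNested {a} {b} {c} {d} a∈W b∈W c∈W d∈W v⇒a a⇒b b⇒v v⇒c c⇒d d⇒v a⇒c b⇒c d⇒a d⇒b =
        closureModule G v⇒a a⇒b b⇒v v∈W a∈W b∈W (v⇒c , d⇒v , v∈W) (a⇒c , d⇒a , a∈W) (b⇒c , d⇒b , b∈W) closed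
          λ (M , isM , v∈M , a∈M , _ , M⊆Z) →
            loopless G c (proj₁ (M⊆Z (noModule isM v∈M a∈M (λ { refl → loopless G v v⇒a }) c∈W)))
        where
        Z : Pred (Fin n) 0ℓ
        Z x = x ⇒ c × d ⇒ x × x ∈ W
        closed : ∀ {q r x} → Z q → Z r → x ∈ W → q ⇒ r → r ⇒ x → x ⇒ q → Z x
        closed {q} {r} {x} (q⇒c , d⇒q , q∈W) (r⇒c , d⇒r , r∈W) x∈W q⇒r r⇒x x⇒q with compare G x c | compare G x d
        ... | inj₁ refl | _ = ⊥-elim (asym G x⇒q q⇒c)
        ... | _ | inj₁ refl = ⊥-elim (asym G r⇒x d⇒r)
        ... | inj₂ (inj₁ x⇒c) | inj₂ (inj₂ d⇒x) = x⇒c , d⇒x , x∈W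
        ... | inj₂ (inj₂ c⇒x) | inj₂ (inj₁ x⇒d) = ⊥-elim (t5-free x∈W d∈W q∈W r∈W c∈W
          (t5 x⇒d x⇒q d⇒q d⇒r q⇒r q⇒c r⇒c r⇒x c⇒x c⇒d))
        ... | inj₂ (inj₂ c⇒x) | inj₂ (inj₂ d⇒x) =
          ⊥-elim (u5-free d⇒x x⇒q d⇒q d⇒r q⇒r q⇒c r⇒c r⇒x c⇒x c⇒d)
        ... | inj₂ (inj₁ x⇒c) | inj₂ (inj₁ x⇒d) =
          ⊥-elim (u5-free x⇒c c⇒d x⇒d x⇒q d⇒q d⇒r q⇒r q⇒c r⇒c r⇒x)

      -- This is the induced matching. If the edge between `a` and `c` and the edge between `b` and
      -- `d` run the same way, there is a U₅; if they run opposite ways, one triangle is nested in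
      -- the other as in `noNested`.
      noMatching : ∀ {a b c d} → a ∈ W → b ∈ W → c ∈ W → d ∈ W → v ⇒ a → a ⇒ b → b ⇒ v →
        v ⇒ c → c ⇒ d → d ⇒ v → b ⇒ c → d ⇒ a → ⊥
      noMatching {a} {b} {c} {d} a∈W b∈W c∈W d∈W v⇒a a⇒b b⇒v v⇒c c⇒d d⇒v b⇒c d⇒a
        with compare G a c | compare G b d
      ... | inj₁ refl | _ = asym G a⇒b b⇒c
      ... | _ | inj₁ refl = asym G c⇒d b⇒c
      ... | inj₂ (inj₁ a⇒c) | inj₂ (inj₁ b⇒d) = u5-free b⇒c c⇒d b⇒d b⇒v d⇒v d⇒a v⇒a v⇒c a⇒c a⇒b
      ... | inj₂ (inj₂ c⇒a) | inj₂ (inj₂ d⇒b) = u5-free d⇒a a⇒b d⇒b d⇒v b⇒v b⇒c v⇒c v⇒a c⇒a c⇒d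
      ... | inj₂ (inj₁ a⇒c) | inj₂ (inj₂ d⇒b) =
        noNested a∈W b∈W c∈W d∈W v⇒a a⇒b b⇒v v⇒c c⇒d d⇒v a⇒c b⇒c d⇒a d⇒b
      ... | inj₂ (inj₂ c⇒a) | inj₂ (inj₁ b⇒d) =
        noNested c∈W d∈W a∈W b∈W v⇒c c⇒d d⇒v v⇒a a⇒b b⇒v c⇒a d⇒a b⇒c b⇒d

      -- `z`, `v`, `x`, `y`, `b` would be v₁ to v₅ of U₅.
      notTwo : ∀ {b x y z} → b ⇒ v → v ⇒ x → v ⇒ y → v ⇒ z → x ⇒ y → y ⇒ z → z ⇒ x →
        x ⇒ b → y ⇒ b → b ⇒ z → ⊥
      notTwo b⇒v v⇒x v⇒y v⇒z x⇒y y⇒z z⇒x x⇒b y⇒b b⇒z = u5-free v⇒z z⇒x v⇒x v⇒y x⇒y x⇒b y⇒b y⇒z b⇒z b⇒v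

      -- If `b ⇒ c`, then `c`, `b`, `v`, `q`, `p` are v₁ to v₅ of U₅; if `c ⇒ b`, then `v`, `q`,
      -- `p`, `c`, `b` form a T₅.
      noPath : ∀ {p q b c} → p ∈ W → q ∈ W → b ∈ W → c ∈ W → v ⇒ p → v ⇒ q → b ⇒ v → c ⇒ v →
        q ⇒ c → p ⇒ c → p ⇒ b → b ⇒ q → q ⇒ p → ⊥
      noPath {p} {q} {b} {c} p∈W q∈W b∈W c∈W v⇒p v⇒q b⇒v c⇒v q⇒c p⇒c p⇒b b⇒q q⇒p with compare G b c
      ... | inj₁ refl = asym G q⇒c b⇒q
      ... | inj₂ (inj₁ b⇒c) = u5-free b⇒c c⇒v b⇒v b⇒q v⇒q v⇒p q⇒p q⇒c p⇒c p⇒b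
      ... | inj₂ (inj₂ c⇒b) = t5-free v∈W q∈W p∈W c∈W b∈W (t5 v⇒q v⇒p q⇒p q⇒c p⇒c p⇒b c⇒b c⇒v b⇒v b⇒q)

      Link : Fin n → Fin n → Set
      Link b a = a ∈ W × v ⇒ a × a ⇒ b

      link? : ∀ b → Decidable (Link b)
      link? b a = (a ∈? W) ×-dec edge? G v a ×-dec edge? G a b

      Base : Pred (Fin n) 0ℓ
      Base b = b ∈ W × b ⇒ v

      base? : Decidable Base
      base? b = (b ∈? W) ×-dec edge? G b v

      Out : Pred (Fin n) 0ℓ
      Out x = x ∈ W × v ⇒ x

      out? : Decidable Out
      out? x = (x ∈? W) ×-dec edge? G v x

      v∉out : v ∉ ⟪ out? ⟫
      v∉out v∈ = loopless G v (proj₂ (∈⟪⟫⁻ out? v∈))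

      -- Without an induced matching the sets of vertices linked to the various in-neighbours form a
      -- chain under inclusion, so one of largest size contains them all.
      widest : ∀ {b} → Base b → Σ (Fin n) λ c → Base c × (∀ {b a} → Base b → Link b a → a ⇒ c)
      widest {b} hb with argmax base? (λ b → ∣ ⟪ link? b ⟫ ∣) (b , hb)
      ... | c , hc@(c∈W , c⇒v) , max = c , hc , λ {b} {a} → reach b a
        where
        reach : ∀ b a → Base b → Link b a → a ⇒ c
        reach b a hb@(b∈W , b⇒v) (a∈W , v⇒a , a⇒b) with compare G a c
        ... | inj₁ refl = ⊥-elim (asym G v⇒a c⇒v)
        ... | inj₂ (inj₁ a⇒c) = a⇒c
        ... | inj₂ (inj₂ c⇒a) = contradiction (max hb) (<⇒≱ (p⊂q⇒∣p∣<∣q∣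
          ( (λ x∈ → ∈⟪⟫⁺ (link? b) (widen (∈⟪⟫⁻ (link? c) x∈)))
          , a , ∈⟪⟫⁺ (link? b) (a∈W , v⇒a , a⇒b) , λ a∈ → asym G c⇒a (proj₂ (proj₂ (∈⟪⟫⁻ (link? c) a∈))))))
          where
          widen : ∀ {x} → Link c x → Link b x
          widen {x} (x∈W , v⇒x , x⇒c) with compare G x b
          ... | inj₁ refl = ⊥-elim (asym G v⇒x b⇒v)
          ... | inj₂ (inj₁ x⇒b) = x∈W , v⇒x , x⇒b
          ... | inj₂ (inj₂ b⇒x) = ⊥-elim (noMatching a∈W b∈W x∈W c∈W v⇒a a⇒b b⇒v v⇒x x⇒c c⇒v b⇒x c⇒a)

      module Linked {c : Fin n} (c∈W : c ∈ W) (c⇒v : c ⇒ v)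
        (reach : ∀ {b a} → Base b → Link b a → a ⇒ c) where

        -- By `notTwo` and `noPath`, the vertices of a triangle inside `Link c` have the same
        -- relations to all in-neighbours of `v`. Hence the closure stays inside `Link c` and avoids
        -- `v`; as a module it is acyclic by `tame`, yet it contains the triangle.
        linkedTriangle : ∀ {p q r} → Link c p → Link c q → Link c r → p ⇒ q → q ⇒ r → r ⇒ p → ⊥
        linkedTriangle {p} {q} {r} lp@(p∈W , _) lq@(q∈W , _) lr@(r∈W , _) p⇒q q⇒r r⇒p =
          closureModule G p⇒q q⇒r r⇒p p∈W q∈W r∈W
            (lp , λ {b} _ → (λ h → h) , (λ h → h))
            (lq , λ {b} hb → same hb lp lq lr p⇒q q⇒r r⇒p , λ h → same hb lr lp lq r⇒p p⇒q q⇒r (same hb lq lr lp q⇒r r⇒p p⇒q h))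
            (lr , λ {b} hb → (λ h → same hb lq lr lp q⇒r r⇒p p⇒q (same hb lp lq lr p⇒q q⇒r r⇒p h)) , same hb lr lp lq r⇒p p⇒q q⇒r)
            closed λ (M , isM , p∈M , q∈M , r∈M , M⊆Z) →
              tame isM (λ v∈M → loopless G v (proj₁ (proj₂ (proj₁ (M⊆Z v∈M))))) p∈M q∈M r∈M p⇒q q⇒r r⇒p
          where
          same : ∀ {p q r b} → Base b → Link c p → Link c q → Link c r → p ⇒ q → q ⇒ r → r ⇒ p → p ⇒ b → q ⇒ b
          same {p} {q} {r} {b} (b∈W , b⇒v) (p∈W , v⇒p , p⇒c) (q∈W , v⇒q , q⇒c) (r∈W , v⇒r , r⇒c) p⇒q q⇒r r⇒p p⇒b
            with compare G q b | compare G r b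
          ... | inj₁ refl | _ = ⊥-elim (asym G v⇒q b⇒v)
          ... | inj₂ (inj₁ q⇒b) | _ = q⇒b
          ... | _ | inj₁ refl = ⊥-elim (asym G v⇒r b⇒v)
          ... | inj₂ (inj₂ b⇒q) | inj₂ (inj₁ r⇒b) = ⊥-elim (notTwo b⇒v v⇒r v⇒p v⇒q r⇒p p⇒q q⇒r r⇒b p⇒b b⇒q)
          ... | inj₂ (inj₂ b⇒q) | inj₂ (inj₂ b⇒r) =
            ⊥-elim (noPath p∈W r∈W b∈W c∈W v⇒p v⇒r b⇒v c⇒v r⇒c p⇒c p⇒b b⇒r r⇒p)
          Z : Pred (Fin n) 0ℓ
          Z x = Link c x × (∀ {b} → Base b → (p ⇒ b → x ⇒ b) × (x ⇒ b → p ⇒ b))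
          closed : ∀ {q r x} → Z q → Z r → x ∈ W → q ⇒ r → r ⇒ x → x ⇒ q → Z x
          closed {q} {r} {x} (lq@(_ , v⇒q , q⇒c) , hq) (lr@(_ , v⇒r , r⇒c) , hr) x∈W q⇒r r⇒x x⇒q with compare G x v
          ... | inj₁ refl = ⊥-elim (asym G v⇒r r⇒x)
          ... | inj₂ (inj₁ x⇒v) = ⊥-elim (asym G x⇒q (proj₁ (hq (x∈W , x⇒v)) (proj₂ (hr (x∈W , x⇒v)) r⇒x)))
          ... | inj₂ (inj₂ v⇒x) with compare G x c
          ...   | inj₁ refl = ⊥-elim (asym G v⇒x c⇒v)
          ...   | inj₂ (inj₂ c⇒x) = ⊥-elim (notTwo c⇒v v⇒q v⇒r v⇒x q⇒r r⇒x x⇒q q⇒c r⇒c c⇒x)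
          ...   | inj₂ (inj₁ x⇒c) = lx , λ {b} hb →
            (λ h → same hb lr lx lq r⇒x x⇒q q⇒r (proj₁ (hr hb) h)) , λ h → proj₂ (hq hb) (same hb lx lq lr x⇒q q⇒r r⇒x h)
            where
            lx : Link c x
            lx = x∈W , v⇒x , x⇒c

        Next? : Decidable (λ x → x ∈ W × (v ⇒ x ⊎ x ≡ c))
        Next? x = (x ∈? W) ×-dec (edge? G v x ⊎-dec (x Fin.≟ c))

        next : Subset n
        next = ⟪ Next? ⟫

        next⊂W : next ⊂ W
        next⊂W = (λ x∈ → proj₁ (∈⟪⟫⁻ Next? x∈)) , v , v∈W , λ v∈ → notNext (proj₂ (∈⟪⟫⁻ Next? v∈))
          where
          notNext : v ⇒ v ⊎ v ≡ c → ⊥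
          notNext (inj₁ v⇒v) = loopless G v v⇒v
          notNext (inj₂ refl) = loopless G v c⇒v

        c∈next : c ∈ next
        c∈next = ∈⟪⟫⁺ Next? (c∈W , inj₂ refl)

        ∈next : ∀ {x} → x ∈ W → v ⇒ x → x ∈ next
        ∈next x∈W v⇒x = ∈⟪⟫⁺ Next? (x∈W , inj₁ v⇒x)

        -- If one vertex of `N` dominates `c`, all do, and `linkedTriangle` applies. Otherwise `c`
        -- dominates `N`; by `reach` so does every in-neighbour of `v`, and `N` is a module of `W`.
        tame-next : Tame next c
        tame-next {N} isN c∉N {p} {q} {r} p∈N q∈N r∈N p⇒q q⇒r r⇒p with edge? G p c
        ... | yes p⇒c = linkedTriangle (toLink p∈N) (toLink q∈N) (toLink r∈N) p⇒q q⇒r r⇒p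
          where
          open IsModule isN
          toLink : ∀ {x} → x ∈ N → Link c x
          toLink x∈N with ∈⟪⟫⁻ Next? (⊆W x∈N)
          ... | x∈W , inj₁ v⇒x = x∈W , v⇒x , hom′ c∈next c∉N p∈N x∈N p⇒c
          ... | _ , inj₂ refl = contradiction x∈N c∉N
        ... | no p⇏c = tame isW v∉N p∈N q∈N r∈N p⇒q q⇒r r⇒p
          where
          open IsModule isN
          outN : ∀ {x} → x ∈ N → Out x
          outN x∈N with ∈⟪⟫⁻ Next? (⊆W x∈N)
          ... | x∈W , inj₁ v⇒x = x∈W , v⇒x
          ... | _ , inj₂ refl = contradiction x∈N c∉N
          v∉N : v ∉ N
          v∉N v∈N = loopless G v (proj₂ (outN v∈N))
          isW : IsModule G W N
          isW = record { ⊆W = proj₁ ∘ outN ; hom = hom-W }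
            where
            hom-W : ∀ {x p q} → x ∈ W → x ∉ N → p ∈ N → q ∈ N → x ⇒ p → x ⇒ q
            hom-W {x} {q = q} x∈W x∉N p′∈N q∈N x⇒p with compare G x v | compare G x q
            ... | inj₁ refl | _ = proj₂ (outN q∈N)
            ... | inj₂ (inj₂ v⇒x) | _ = hom (∈next x∈W v⇒x) x∉N p′∈N q∈N x⇒p
            ... | _ | inj₁ refl = contradiction q∈N x∉N
            ... | _ | inj₂ (inj₁ x⇒q) = x⇒q
            ... | inj₂ (inj₁ x⇒v) | inj₂ (inj₂ q⇒x) =
              contradiction (hom′ c∈next c∉N q∈N p∈N (reach (x∈W , x⇒v) (proj₁ (outN q∈N) , proj₂ (outN q∈N) , q⇒x))) p⇏c

        module _ (C : LinkedCover next c) where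
          private
            module C = LinkedCover C

            A₀? : Decidable (λ x → Out x × (x ⇒ c ⊎ x ∈ C.Q))
            A₀? x = out? x ×-dec (edge? G x c ⊎-dec (x ∈? C.Q))

            A₁? : Decidable (λ x → Out x × c ⇒ x × x ∈ C.P)
            A₁? x = out? x ×-dec edge? G c x ×-dec (x ∈? C.P)

            pulled : ∀ {a b} → Out a → a ⇒ c → Out b → c ⇒ b → b ⇒ a → a ∈ C.Q
            pulled (a∈W , v⇒a) a⇒c (b∈W , v⇒b) c⇒b b⇒a =
              proj₂ (C.linked (∈next b∈W v⇒b) (∈next a∈W v⇒a) c⇒b b⇒a a⇒c)

            data Kind (x : Fin n) : Set where
              inside : Out x → x ⇒ c → Kind x
              outside : Out x → c ⇒ x → x ∈ C.Q → Kind x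

            kind : ∀ {x} → x ∈ ⟪ A₀? ⟫ → Kind x
            kind {x} x∈ with ∈⟪⟫⁻ A₀? x∈ | compare G x c
            ... | (_ , v⇒x) , _ | inj₁ refl = ⊥-elim (asym G v⇒x c⇒v)
            ... | o , _ | inj₂ (inj₁ x⇒c) = inside o x⇒c
            ... | o , inj₁ x⇒c | inj₂ (inj₂ c⇒x) = ⊥-elim (asym G x⇒c c⇒x)
            ... | o , inj₂ x∈Q | inj₂ (inj₂ c⇒x) = outside o c⇒x x∈Q

            -- A triangle with exactly two vertices dominating `c` is excluded by `notTwo`. If only
            -- one dominates `c`, it closes a triangle through `c` with its predecessor, and
            -- `linked` for the cover at `c` puts it into `C.Q` with the other two.
            acyclic : ∀ {x y z} → Kind x → Kind y → Kind z → x ⇒ y → y ⇒ z → z ⇒ x → ⊥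
            acyclic (inside (x∈W , v⇒x) x⇒c) (inside (y∈W , v⇒y) y⇒c) (inside (z∈W , v⇒z) z⇒c) =
              linkedTriangle (x∈W , v⇒x , x⇒c) (y∈W , v⇒y , y⇒c) (z∈W , v⇒z , z⇒c)
            acyclic (inside (_ , v⇒x) x⇒c) (inside (_ , v⇒y) y⇒c) (outside (_ , v⇒z) c⇒z _) x⇒y y⇒z z⇒x =
              notTwo c⇒v v⇒x v⇒y v⇒z x⇒y y⇒z z⇒x x⇒c y⇒c c⇒z
            acyclic (outside (_ , v⇒x) c⇒x _) (inside (_ , v⇒y) y⇒c) (inside (_ , v⇒z) z⇒c) x⇒y y⇒z z⇒x =
              notTwo c⇒v v⇒y v⇒z v⇒x y⇒z z⇒x x⇒y y⇒c z⇒c c⇒x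
            acyclic (inside (_ , v⇒x) x⇒c) (outside (_ , v⇒y) c⇒y _) (inside (_ , v⇒z) z⇒c) x⇒y y⇒z z⇒x =
              notTwo c⇒v v⇒z v⇒x v⇒y z⇒x x⇒y y⇒z z⇒c x⇒c c⇒y
            acyclic (inside ox x⇒c) (outside oy c⇒y y∈Q) (outside oz c⇒z z∈Q) x⇒y y⇒z z⇒x =
              C.acyclicQ (pulled ox x⇒c oz c⇒z z⇒x) y∈Q z∈Q x⇒y y⇒z z⇒x
            acyclic (outside ox c⇒x x∈Q) (inside oy y⇒c) (outside oz c⇒z z∈Q) x⇒y y⇒z z⇒x =
              C.acyclicQ x∈Q (pulled oy y⇒c ox c⇒x x⇒y) z∈Q x⇒y y⇒z z⇒x
            acyclic (outside ox c⇒x x∈Q) (outside oy c⇒y y∈Q) (inside oz z⇒c) x⇒y y⇒z z⇒x =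
              C.acyclicQ x∈Q y∈Q (pulled oz z⇒c oy c⇒y y⇒z) x⇒y y⇒z z⇒x
            acyclic (outside _ _ x∈Q) (outside _ _ y∈Q) (outside _ _ z∈Q) = C.acyclicQ x∈Q y∈Q z∈Q

            splits : ∀ {x} → x ∈ W → v ⇒ x → x ∈ ⟪ A₀? ⟫ ⊎ x ∈ ⟪ A₁? ⟫
            splits {x} x∈W v⇒x with compare G x c | C.cover (∈next x∈W v⇒x)
            ... | inj₁ refl | _ = ⊥-elim (asym G v⇒x c⇒v)
            ... | inj₂ (inj₁ x⇒c) | _ = inj₁ (∈⟪⟫⁺ A₀? ((x∈W , v⇒x) , inj₁ x⇒c))
            ... | _ | inj₂ x∈Q = inj₁ (∈⟪⟫⁺ A₀? ((x∈W , v⇒x) , inj₂ x∈Q))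
            ... | inj₂ (inj₂ c⇒x) | inj₁ x∈P = inj₂ (∈⟪⟫⁺ A₁? ((x∈W , v⇒x) , c⇒x , x∈P))

            outer : ∀ {a b} → a ∈ ⟪ A₁? ⟫ → b ∈ W → b ⇒ v → b ⇒ a
            outer {a} {b} a∈ b∈W b⇒v with ∈⟪⟫⁻ A₁? a∈ | compare G b a
            ... | (_ , v⇒a) , _ | inj₁ refl = ⊥-elim (asym G v⇒a b⇒v)
            ... | _ | inj₂ (inj₁ b⇒a) = b⇒a
            ... | (a∈W , v⇒a) , c⇒a , _ | inj₂ (inj₂ a⇒b) =
              ⊥-elim (asym G c⇒a (reach (b∈W , b⇒v) (a∈W , v⇒a , a⇒b)))

          outSplit : OutSplit W v
          outSplit = record
            { A₀ = ⟪ A₀? ⟫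
            ; A₁ = ⟪ A₁? ⟫
            ; A₀⊆ = λ x∈ → proj₁ (∈⟪⟫⁻ A₀? x∈)
            ; A₁⊆ = λ x∈ → proj₁ (∈⟪⟫⁻ A₁? x∈)
            ; split = splits
            ; acyclic₀ = λ x∈ y∈ z∈ → acyclic (kind x∈) (kind y∈) (kind z∈)
            ; acyclic₁ = λ x∈ y∈ z∈ →
                C.acyclicP (proj₂ (proj₂ (∈⟪⟫⁻ A₁? x∈))) (proj₂ (proj₂ (∈⟪⟫⁻ A₁? y∈))) (proj₂ (proj₂ (∈⟪⟫⁻ A₁? z∈)))
            ; inner = λ a∈W b∈W v⇒a a⇒b b⇒v →
                ∈⟪⟫⁺ A₀? ((a∈W , v⇒a) , inj₁ (reach (b∈W , b⇒v) (a∈W , v⇒a , a⇒b)))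
            ; outer = outer
            }

    outSplitting :
      (∀ {W′ v′} → W′ ⊂ W → v′ ∈ W′ → Tame W′ v′ → LinkedCover W′ v′) → OutSplit W v
    outSplitting rec with Fin.any? (λ b → base? b ×-dec Fin.any? (link? b))
    ... | yes (_ , hb , _) with widest hb
    ...   | c , (c∈W , c⇒v) , reach = outSplit (rec next⊂W c∈next tame-next)
      where open Linked c∈W c⇒v reach
    -- No out-neighbour of `v` dominates an in-neighbour, so the whole out-neighbourhood is a module
    -- avoiding `v`, acyclic by `tame`.
    outSplitting rec | no unlinked = record
      { A₀ = ⟪ out? ⟫
      ; A₁ = ∅
      ; A₀⊆ = ∈⟪⟫⁻ out?
      ; A₁⊆ = λ x∈ → contradiction x∈ ∉⊥
      ; split = λ x∈W v⇒x → inj₁ (∈⟪⟫⁺ out? (x∈W , v⇒x))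
      ; acyclic₀ = tame record { ⊆W = proj₁ ∘ ∈⟪⟫⁻ out? ; hom = hom } v∉out
      ; acyclic₁ = λ x∈ → contradiction x∈ ∉⊥
      ; inner = λ a∈W _ v⇒a _ _ → ∈⟪⟫⁺ out? (a∈W , v⇒a)
      ; outer = λ a∈ → contradiction a∈ ∉⊥
      }
      where
      hom : ∀ {x p q} → x ∈ W → x ∉ ⟪ out? ⟫ → p ∈ ⟪ out? ⟫ → q ∈ ⟪ out? ⟫ → x ⇒ p → x ⇒ q
      hom {x} {q = q} x∈W x∉ _ q∈ _ with ∈⟪⟫⁻ out? q∈ | compare G x v | compare G x q
      ... | _ , v⇒q | inj₁ refl | _ = v⇒q
      ... | _ | inj₂ (inj₂ v⇒x) | _ = contradiction (∈⟪⟫⁺ out? (x∈W , v⇒x)) x∉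
      ... | _ | _ | inj₁ refl = contradiction q∈ x∉
      ... | _ | _ | inj₂ (inj₁ x⇒q) = x⇒q
      ... | q∈W , v⇒q | inj₂ (inj₁ x⇒v) | inj₂ (inj₂ q⇒x) =
        contradiction (x , (x∈W , x⇒v) , q , q∈W , v⇒q , q⇒x) unlinked

-- Reversal, and recombination of the two neighbourhoods

module _ {n : ℕ} (G : Tournament n) where

  private
    _⇒_ = _⟶_ G

  -- U₅ is isomorphic to its reversal, by exchanging v₁ with v₂ and v₃ with v₅.
  noU5-op : NoU5 G → NoU5 (op G)
  noU5-op u5-free e₂₁ e₁₃ e₂₃ e₂₄ e₃₄ e₃₅ e₄₅ e₄₁ e₅₁ e₅₂ =
    u5-free e₂₁ e₅₂ e₅₁ e₄₁ e₄₅ e₃₅ e₃₄ e₂₄ e₂₃ e₁₃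

  t5-op : ∀ {a b c d e} → T5 (op G) a b c d e → T5 G a e d c b
  t5-op (t5 e₀₁ e₀₂ e₁₂ e₁₃ e₂₃ e₂₄ e₃₄ e₃₀ e₄₀ e₄₁) = t5 e₄₀ e₃₀ e₃₄ e₂₄ e₂₃ e₁₃ e₁₂ e₀₂ e₀₁ e₄₁

  noT5-op : ∀ {W} → NoT5 G W → NoT5 (op G) W
  noT5-op t5-free a∈ b∈ c∈ d∈ e∈ F = t5-free a∈ e∈ d∈ c∈ b∈ (t5-op F)

  acyclic-op : ∀ {T} → Acyclic G T → Acyclic (op G) T
  acyclic-op acyclic x∈ y∈ z∈ y⇒x z⇒y x⇒z = acyclic x∈ z∈ y∈ x⇒z z⇒y y⇒x

  module-op : ∀ {W M} → IsModule (op G) W M → IsModule G W M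
  module-op isM = record { ⊆W = IsModule.⊆W isM ; hom = IsModule.hom′ isM }

  tame-op : ∀ {W v} → Tame G W v → Tame (op G) W v
  tame-op tame isM v∉M = acyclic-op (tame (module-op isM) v∉M)

  prime-op : ∀ {W} → Prime G W → Prime (op G) W
  prime-op prime isM = prime (module-op isM)

  module _ {W : Subset n} {v : Fin n} (v∈W : v ∈ W) where

    data Part (I O : Subset n) (x : Fin n) : ℕ → Set where
      before : x ∈ I → Part I O x 0
      centre : x ≡ v → Part I O x 1
      after : x ∈ O → Part I O x 2

    sandwich : ∀ {I O} → (∀ {x} → x ∈ I → x ∈ W × x ⇒ v) → (∀ {x} → x ∈ O → x ∈ W × v ⇒ x) →
      (∀ {x y} → x ∈ I → y ∈ O → x ⇒ y) → Acyclic G I → Acyclic G O →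
      Σ (Subset n) λ P → P ⊆ W × v ∈ P × I ⊆ P × O ⊆ P × Acyclic G P
    sandwich {I} {O} I⊆ O⊆ I⇒O acyclicI acyclicO =
      ⟪ P? ⟫ , (λ x∈ → P⊆W (∈⟪⟫⁻ P? x∈)) , ∈⟪⟫⁺ P? (inj₂ (inj₁ refl)) , ∈⟪⟫⁺ P? ∘ inj₁
      , ∈⟪⟫⁺ P? ∘ inj₂ ∘ inj₂
      , λ x∈ y∈ z∈ → layeredAcyclic G mono flat (proj₂ (part x∈)) (proj₂ (part y∈)) (proj₂ (part z∈))
      where
      P? : Decidable (λ x → x ∈ I ⊎ x ≡ v ⊎ x ∈ O)
      P? x = (x ∈? I) ⊎-dec ((x Fin.≟ v) ⊎-dec (x ∈? O))
      P⊆W : ∀ {x} → x ∈ I ⊎ x ≡ v ⊎ x ∈ O → x ∈ W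
      P⊆W (inj₁ x∈I) = proj₁ (I⊆ x∈I)
      P⊆W (inj₂ (inj₁ refl)) = v∈W
      P⊆W (inj₂ (inj₂ x∈O)) = proj₁ (O⊆ x∈O)
      part : ∀ {x} → x ∈ ⟪ P? ⟫ → Σ ℕ (Part I O x)
      part x∈ with ∈⟪⟫⁻ P? x∈
      ... | inj₁ x∈I = 0 , before x∈I
      ... | inj₂ (inj₁ x≡v) = 1 , centre x≡v
      ... | inj₂ (inj₂ x∈O) = 2 , after x∈O
      mono : ∀ {p q i j} → Part I O p i → Part I O q j → p ⇒ q → i ≤ j
      mono (before _) _ _ = z≤n
      mono (centre refl) (before q∈I) v⇒q = ⊥-elim (asym G v⇒q (proj₂ (I⊆ q∈I)))
      mono (centre _) (centre _) _ = s≤s z≤n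
      mono (centre _) (after _) _ = s≤s z≤n
      mono (after p∈O) (before q∈I) p⇒q = ⊥-elim (asym G p⇒q (I⇒O q∈I p∈O))
      mono (after p∈O) (centre refl) p⇒v = ⊥-elim (asym G p⇒v (proj₂ (O⊆ p∈O)))
      mono (after _) (after _) _ = s≤s (s≤s z≤n)
      flat : ∀ {p q r i} → Part I O p i → Part I O q i → Part I O r i → p ⇒ q → q ⇒ r → r ⇒ p → ⊥
      flat (before p∈) (before q∈) (before r∈) = acyclicI p∈ q∈ r∈
      flat (centre refl) (centre refl) _ v⇒v _ _ = loopless G v v⇒v
      flat (after p∈) (after q∈) (after r∈) = acyclicO p∈ q∈ r∈

    -- `T` splits the in-neighbourhood. In `G`, `T.A₁` dominates all out-neighbours of `v` and may
    -- precede `S.A₀`; all in-neighbours dominate `S.A₁`, so `T.A₀` may precede it. The two `A₀`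
    -- parts, which hold the triangles through `v`, thus go to different sets, as `linked` requires.
    assemble : OutSplit G W v → OutSplit (op G) W v → LinkedCover G W v
    assemble S T with sandwich T.A₁⊆ S.A₀⊆ (λ x∈ y∈ → T.outer x∈ (proj₁ (S.A₀⊆ y∈)) (proj₂ (S.A₀⊆ y∈)))
                        (λ x∈ y∈ z∈ x⇒y y⇒z z⇒x → T.acyclic₁ x∈ z∈ y∈ z⇒x y⇒z x⇒y) S.acyclic₀
                    | sandwich T.A₀⊆ S.A₁⊆ (λ x∈ y∈ → S.outer y∈ (proj₁ (T.A₀⊆ x∈)) (proj₂ (T.A₀⊆ x∈)))
                        (λ x∈ y∈ z∈ x⇒y y⇒z z⇒x → T.acyclic₀ x∈ z∈ y∈ z⇒x y⇒z x⇒y) S.acyclic₁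
      where
      module S = OutSplit S
      module T = OutSplit T
    ... | P , P⊆W , v∈P , I⊆P , O⊆P , acyclicP | Q , Q⊆W , v∈Q , I⊆Q , O⊆Q , acyclicQ = record
      { base = record
        { P = P
        ; Q = Q
        ; P⊆W = P⊆W
        ; Q⊆W = Q⊆W
        ; v∈P = v∈P
        ; v∈Q = v∈Q
        ; cover = cover
        ; acyclicP = acyclicP
        ; acyclicQ = acyclicQ
        }
      ; linked = λ a∈W b∈W v⇒a a⇒b b⇒v → O⊆P (S.inner a∈W b∈W v⇒a a⇒b b⇒v) , I⊆Q (T.inner b∈W a∈W b⇒v a⇒b v⇒a)
      }
      where
      module S = OutSplit S
      module T = OutSplit T
      cover : ∀ {x} → x ∈ W → x ∈ P ⊎ x ∈ Q
      cover {x} x∈W with compare G x v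
      ... | inj₁ refl = inj₁ v∈P
      ... | inj₂ (inj₂ v⇒x) = [ inj₁ ∘ O⊆P , inj₂ ∘ O⊆Q ]′ (S.split x∈W v⇒x)
      ... | inj₂ (inj₁ x⇒v) = [ inj₂ ∘ I⊆Q , inj₁ ∘ I⊆P ]′ (T.split x∈W x⇒v)

-- Induction on the size of `W`, with `k` as bound. A proper module containing `v` and another
-- vertex is treated by `glue`; if there is none, the neighbourhoods are split in `G` and in its
-- reversal.
linkedCover : ∀ {n} k (G : Tournament n) {W v} → ∣ W ∣ < k → NoU5 G → NoT5 G W → v ∈ W → Tame G W v →
  LinkedCover G W v
linkedCover (suc k) G {W} {v} (s≤s ∣W∣≤k) u5-free t5-free v∈W tame
  with anySubset? (λ M → isModule? G W M ×-dec (v ∈? M)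
         ×-dec Fin.any? (λ y → (y ∈? M) ×-dec ¬? (y Fin.≟ v))
         ×-dec Fin.any? (λ z → (z ∈? W) ×-dec ¬? (z ∈? M)))
... | yes (M , isM , v∈M , (y , y∈M , y≢v) , (z , z∈W , z∉M)) = glue G isM v∈M
  (linkedCover k G (<-≤-trans (p⊂q⇒∣p∣<∣q∣ (IsModule.⊆W isM , z , z∈W , z∉M)) ∣W∣≤k) u5-free
    (λ a∈ b∈ c∈ d∈ e∈ → t5-free (⊆W a∈) (⊆W b∈) (⊆W c∈) (⊆W d∈) (⊆W e∈)) v∈M (tame-M G isM v∈M tame))
  (linkedCover k G (<-≤-trans (p⊂q⇒∣p∣<∣q∣ (r⊆W , y , ⊆W y∈M , λ y∈ → y≢v (rest∩M G isM v∈M y∈ y∈M))) ∣W∣≤k) u5-free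
    (λ a∈ b∈ c∈ d∈ e∈ → t5-free (r⊆W a∈) (r⊆W b∈) (r⊆W c∈) (r⊆W d∈) (r⊆W e∈)) (v∈rest G isM v∈M)
    (tame-rest G isM v∈M tame))
  where
  open IsModule isM
  r⊆W : rest G isM v∈M ⊆ W
  r⊆W = rest⊆W G isM v∈M
... | no none = assemble G v∈W
  (outSplitting G u5-free t5-free v∈W tame (λ isM → noModule isM)
    (λ W′⊂W → linkedCover k G (<-≤-trans (p⊂q⇒∣p∣<∣q∣ W′⊂W) ∣W∣≤k) u5-free (λ a∈ b∈ c∈ d∈ e∈ →
      t5-free (proj₁ W′⊂W a∈) (proj₁ W′⊂W b∈) (proj₁ W′⊂W c∈) (proj₁ W′⊂W d∈) (proj₁ W′⊂W e∈))))
  (outSplitting (op G) (noU5-op G u5-free) (noT5-op G t5-free) v∈W (tame-op G tame) (λ isM → noModule (module-op G isM))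
    (λ W′⊂W → linkedCover k (op G) (<-≤-trans (p⊂q⇒∣p∣<∣q∣ W′⊂W) ∣W∣≤k) (noU5-op G u5-free) (noT5-op G (λ a∈ b∈ c∈ d∈ e∈ →
      t5-free (proj₁ W′⊂W a∈) (proj₁ W′⊂W b∈) (proj₁ W′⊂W c∈) (proj₁ W′⊂W d∈) (proj₁ W′⊂W e∈)))))
  where
  noModule : ∀ {M} → IsModule G W M → v ∈ M → ∀ {y} → y ∈ M → y ≢ v → W ⊆ M
  noModule {M} isM v∈M {y} y∈M y≢v {z} z∈W with z ∈? M
  ... | yes z∈M = z∈M
  ... | no z∉M = contradiction (M , isM , v∈M , (y , y∈M , y≢v) , (z , z∈W , z∉M)) none

-- Covers of prime tournaments

module _ {n : ℕ} (G : Tournament n) where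

  private
    _⇒_ = _⟶_ G

  T5In : Subset n → Set
  T5In W = Σ (Fin n) λ a → Σ (Fin n) λ b → Σ (Fin n) λ c → Σ (Fin n) λ d → Σ (Fin n) λ e →
    (a ∈ W × b ∈ W × c ∈ W × d ∈ W × e ∈ W) × T5 G a b c d e

  t5? : ∀ a b c d e → Dec (T5 G a b c d e)
  t5? a b c d e = mapDec
    (λ (e₀₁ , e₀₂ , e₁₂ , e₁₃ , e₂₃ , e₂₄ , e₃₄ , e₃₀ , e₄₀ , e₄₁) → t5 e₀₁ e₀₂ e₁₂ e₁₃ e₂₃ e₂₄ e₃₄ e₃₀ e₄₀ e₄₁)
    (λ (t5 e₀₁ e₀₂ e₁₂ e₁₃ e₂₃ e₂₄ e₃₄ e₃₀ e₄₀ e₄₁) → e₀₁ , e₀₂ , e₁₂ , e₁₃ , e₂₃ , e₂₄ , e₃₄ , e₃₀ , e₄₀ , e₄₁)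
    (edge? G a b ×-dec edge? G a c ×-dec edge? G b c ×-dec edge? G b d ×-dec edge? G c d ×-dec
     edge? G c e ×-dec edge? G d e ×-dec edge? G d a ×-dec edge? G e a ×-dec edge? G e b)

  t5In? : Decidable T5In
  t5In? W = Fin.any? λ a → Fin.any? λ b → Fin.any? λ c → Fin.any? λ d → Fin.any? λ e →
    ((a ∈? W) ×-dec (b ∈? W) ×-dec (c ∈? W) ×-dec (d ∈? W) ×-dec (e ∈? W)) ×-dec t5? a b c d e

  module _ (u5-free : NoU5 G) {W : Subset n} (prime : Prime G W) where

    t5Through : T5In W → ∀ {v} → v ∈ W → Σ (Fin n) λ b → Σ (Fin n) λ c → Σ (Fin n) λ d → Σ (Fin n) λ e →
      (b ∈ W × c ∈ W × d ∈ W × e ∈ W) × T5 G v b c d e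
    t5Through (a , b , c , d , e , (a∈ , b∈ , c∈ , d∈ , e∈) , F) {v} v∈W
      with classify G u5-free F v | noHom G u5-free prime F a∈ b∈ v∈W
    ... | above h | ¬h , _ = contradiction h ¬h
    ... | below h | _ , ¬h = contradiction h ¬h
    ... | twin₀ V | _ = b , c , d , e , (b∈ , c∈ , d∈ , e∈) , replace G F V
    ... | twin₁ V | _ = c , d , e , a , (c∈ , d∈ , e∈ , a∈) , replace G (rotate G F) V
    ... | twin₂ V | _ = d , e , a , b , (d∈ , e∈ , a∈ , b∈) , replace G (rotate G (rotate G F)) V
    ... | twin₃ V | _ = e , a , b , c , (e∈ , a∈ , b∈ , c∈) , replace G (rotate G (rotate G (rotate G F))) V
    ... | twin₄ V | _ = a , b , c , d , (a∈ , b∈ , c∈ , d∈) , replace G (rotate G (rotate G (rotate G (rotate G F)))) V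

module _ {n : ℕ} (G : Tournament n) (u5-free : NoU5 G) {W : Subset n} (prime : Prime G W) where

  private
    _⇒_ = _⟶_ G

  primeCover : ∀ {v} → v ∈ W → Cover G W v
  primeCover {v} v∈W with t5In? G W
  ... | no none = LinkedCover.base (linkedCover (suc ∣ W ∣) G ≤-refl u5-free
    (λ a∈ b∈ c∈ d∈ e∈ F → none (_ , _ , _ , _ , _ , (a∈ , b∈ , c∈ , d∈ , e∈) , F)) v∈W tame)
    where
    tame : Tame G W v
    tame isM v∉M {x} {y} x∈M y∈M z∈M x⇒y _ _ = v∉M (prime isM x∈M y∈M (λ { refl → loopless G x x⇒y }) v∈W)
  ... | yes found with t5Through G u5-free prime found v∈W
  ...   | b , c , d , e , (b∈ , c∈ , d∈ , e∈) , F = record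
    { P = proj₁ left ; Q = proj₁ right
    ; P⊆W = proj₁ (proj₂ left) ; Q⊆W = proj₁ (proj₂ right)
    ; v∈P = proj₁ (proj₂ (proj₂ left)) ; v∈Q = proj₁ (proj₂ (proj₂ right))
    ; cover = cover
    ; acyclicP = proj₂ (proj₂ (proj₂ (proj₂ (proj₂ left))))
    ; acyclicQ = proj₂ (proj₂ (proj₂ (proj₂ (proj₂ right))))
    }
    where
    out? : Decidable (λ x → x ∈ W × v ⇒ x)
    out? x = (x ∈? W) ×-dec edge? G v x
    in? : Decidable (λ x → x ∈ W × x ⇒ v)
    in? x = (x ∈? W) ×-dec edge? G x v
    acyclicO : Acyclic G ⟪ out? ⟫
    acyclicO x∈ y∈ z∈ with ∈⟪⟫⁻ out? x∈ | ∈⟪⟫⁻ out? y∈ | ∈⟪⟫⁻ out? z∈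
    ... | x∈W , v⇒x | y∈W , v⇒y | z∈W , v⇒z =
      outAcyclic G u5-free prime F v∈W b∈ c∈ d∈ x∈W y∈W z∈W v⇒x v⇒y v⇒z
    acyclicI : Acyclic G ⟪ in? ⟫
    acyclicI x∈ y∈ z∈ x⇒y y⇒z z⇒x with ∈⟪⟫⁻ in? x∈ | ∈⟪⟫⁻ in? y∈ | ∈⟪⟫⁻ in? z∈
    ... | x∈W , x⇒v | y∈W , y⇒v | z∈W , z⇒v =
      -- Reversing all edges turns in-neighbours into out-neighbours, and the T₅ into one with
      -- cyclic order `v`, `e`, `d`, `c`, `b`.
      outAcyclic (op G) (noU5-op G u5-free) (prime-op G prime) (t5-op (op G) F) v∈W e∈ d∈ c∈
        x∈W z∈W y∈W x⇒v z⇒v y⇒v z⇒x y⇒z x⇒y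
    left = sandwich G v∈W (λ x∈ → contradiction x∈ ∉⊥) (∈⟪⟫⁻ out?) (λ x∈ → contradiction x∈ ∉⊥)
      (λ x∈ → contradiction x∈ ∉⊥) acyclicO
    right = sandwich G v∈W (∈⟪⟫⁻ in?) (λ x∈ → contradiction x∈ ∉⊥) (λ _ x∈ → contradiction x∈ ∉⊥)
      acyclicI (λ x∈ → contradiction x∈ ∉⊥)
    cover : ∀ {x} → x ∈ W → x ∈ proj₁ left ⊎ x ∈ proj₁ right
    cover {x} x∈W with compare G x v
    ... | inj₁ refl = inj₁ (proj₁ (proj₂ (proj₂ left)))
    ... | inj₂ (inj₁ x⇒v) = inj₂ (proj₁ (proj₂ (proj₂ (proj₂ right))) (∈⟪⟫⁺ in? (x∈W , x⇒v)))
    ... | inj₂ (inj₂ v⇒x) = inj₁ (proj₁ (proj₂ (proj₂ (proj₂ (proj₂ left)))) (∈⟪⟫⁺ out? (x∈W , v⇒x)))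

-- Weighted transitive subtournaments

sum-mono : ∀ {n} {f g : Fin n → ℕ} → (∀ i → f i ≤ g i) → sum f ≤ sum g
sum-mono {zero} f≤g = z≤n
sum-mono {suc n} f≤g = +-mono-≤ (f≤g zero) (sum-mono (f≤g ∘ suc))

sum-mono₂ : ∀ {n} {f g f′ g′ : Fin n → ℕ} → (∀ i → f i + g i ≤ f′ i + g′ i) →
  sum f + sum g ≤ sum f′ + sum g′
sum-mono₂ {f = f} {g} {f′} {g′} h =
  subst₂ _≤_ (∑-distrib-+ f g) (∑-distrib-+ f′ g′) (sum-mono h)

spike : ∀ {n} → Fin n → ℕ → Fin n → ℕ
spike v c i = if does (i Fin.≟ v) then c else 0

sum-spike : ∀ {n} (v : Fin n) c → sum (spike v c) ≡ c
sum-spike {suc n} zero c = trans (cong (c +_) (sum-replicate-zero n)) (+-identityʳ c)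
sum-spike (suc v) c = sum-spike v c

restrict : ∀ {n} → Subset n → (Fin n → ℕ) → Fin n → ℕ
restrict W f i = if does (i ∈? W) then f i else 0

weight : ∀ {n} → Subset n → (Fin n → ℕ) → ℕ
weight W f = sum (restrict W f)

module _ {n : ℕ} {W : Subset n} {f : Fin n → ℕ} where

  restrict-∈ : ∀ {i} → i ∈ W → restrict W f i ≡ f i
  restrict-∈ {i} i∈ with i ∈? W
  ... | yes _ = refl
  ... | no i∉ = contradiction i∈ i∉

  restrict-∉ : ∀ {i} → i ∉ W → restrict W f i ≡ 0
  restrict-∉ {i} i∉ with i ∈? W
  ... | yes i∈ = contradiction i∈ i∉
  ... | no _ = refl

  restrict-≤ : ∀ i → restrict W f i ≤ f i
  restrict-≤ i with i ∈? W
  ... | yes _ = ≤-refl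
  ... | no _ = z≤n

weight-1 : ∀ {n} (T : Subset n) → weight T (const 1) ≡ ∣ T ∣
weight-1 [] = refl
weight-1 (true ∷ T) = cong suc (weight-1 T)
weight-1 (false ∷ T) = weight-1 T

module _ {n : ℕ} {f : Fin n → ℕ} where

  weight-cover : ∀ {W P Q : Subset n} {v} → v ∈ P → v ∈ Q → (∀ {x} → x ∈ W → x ∈ P ⊎ x ∈ Q) →
    weight W f + f v ≤ weight P f + weight Q f
  weight-cover {W} {P} {Q} {v} v∈P v∈Q cover =
    subst (λ c → weight W f + c ≤ weight P f + weight Q f) (sum-spike v (f v)) (sum-mono₂ pointwise)
    where
    pointwise : ∀ i → restrict W f i + spike v (f v) i ≤ restrict P f i + restrict Q f i
    pointwise i with i Fin.≟ v
    ... | yes refl rewrite restrict-∈ {f = f} v∈P | restrict-∈ {f = f} v∈Q = +-monoˡ-≤ (f i) (restrict-≤ {W = W} {f = f} i)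
    ... | no _ rewrite +-identityʳ (restrict W f i) with i ∈? W
    ...   | no _ = z≤n
    ...   | yes i∈ with cover i∈
    ...     | inj₁ i∈P rewrite restrict-∈ {f = f} i∈P = m≤m+n (f i) _
    ...     | inj₂ i∈Q rewrite restrict-∈ {f = f} i∈Q = m≤n+m (f i) _

  weight-point : ∀ {W : Subset n} {v} → v ∈ W → f v ≤ weight W f
  weight-point {W} {v} v∈ = subst (_≤ weight W f) (sum-spike v (f v)) (sum-mono pointwise)
    where
    pointwise : ∀ i → spike v (f v) i ≤ restrict W f i
    pointwise i with i Fin.≟ v
    ... | yes refl rewrite restrict-∈ {f = f} v∈ = ≤-refl
    ... | no _ = z≤n

  weight-pair : ∀ {W : Subset n} {u v} → u ∈ W → v ∈ W → u ≢ v → f u + f v ≤ weight W f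
  weight-pair {W} {u} {v} u∈ v∈ u≢v =
    subst (_≤ weight W f) (trans (∑-distrib-+ (spike u (f u)) (spike v (f v)))
      (cong₂ _+_ (sum-spike u (f u)) (sum-spike v (f v)))) (sum-mono pointwise)
    where
    pointwise : ∀ i → spike u (f u) i + spike v (f v) i ≤ restrict W f i
    pointwise i with i Fin.≟ u | i Fin.≟ v
    ... | yes refl | yes refl = contradiction refl u≢v
    ... | yes refl | no _ rewrite restrict-∈ {f = f} u∈ = ≤-reflexive (+-identityʳ (f i))
    ... | no _ | yes refl rewrite restrict-∈ {f = f} v∈ = ≤-refl
    ... | no _ | no _ = z≤n

  weight-split : ∀ {U W : Subset n} {v} → v ∈ W → v ∉ U → U ⊆ W → (∀ {x} → x ∈ W → x ≢ v → x ∈ U) →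
    weight U f + f v ≡ weight W f
  weight-split {U} {W} {v} v∈W v∉U U⊆W others =
    trans (cong (weight U f +_) (sym (sum-spike v (f v))))
      (trans (sym (∑-distrib-+ (restrict U f) (spike v (f v)))) (sum-cong-≗ pointwise))
    where
    pointwise : ∀ i → restrict U f i + spike v (f v) i ≡ restrict W f i
    pointwise i with i Fin.≟ v
    ... | yes refl rewrite restrict-∈ {f = f} v∈W | restrict-∉ {f = f} v∉U = refl
    ... | no i≢v rewrite +-identityʳ (restrict U f i) with i ∈? W
    ...   | yes i∈ = restrict-∈ {f = f} (others i∈ i≢v)
    ...   | no i∉ = restrict-∉ {f = f} (i∉ ∘ U⊆W)

merge : ∀ {n} → Fin n → ℕ → (Fin n → ℕ) → Fin n → ℕ
merge m c f x = if does (x Fin.≟ m) then c else f x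

module _ {n : ℕ} {f : Fin n → ℕ} {M : Subset n} {m : Fin n} where

  private
    off : Subset n → Fin n → ℕ
    off A i = if does (i ∈? M) then 0 else restrict A f i

  -- Both sides are compared with the sum over `W` outside `M` plus all of `weight M f` placed at
  -- `m`.
  weight-contract : ∀ {W R : Subset n} → m ∈ M → m ∈ R → (∀ {x} → x ∈ W → x ∉ M → x ∈ R) →
    weight W f ≤ weight R (merge m (weight M f) f)
  weight-contract {W} {R} m∈M m∈R W∖M⊆R = begin
    weight W f
      ≤⟨ sum-mono apart ⟩
    sum (λ i → off W i + restrict M f i)
      ≡⟨ ∑-distrib-+ (off W) (restrict M f) ⟩
    sum (off W) + weight M f
      ≡⟨ cong (sum (off W) +_) (sum-spike m (weight M f)) ⟨
    sum (off W) + sum (spike m (weight M f))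
      ≡⟨ ∑-distrib-+ (off W) (spike m (weight M f)) ⟨
    sum (λ i → off W i + spike m (weight M f) i)
      ≤⟨ sum-mono together ⟩
    weight R (merge m (weight M f) f) ∎
    where
    open ≤-Reasoning
    apart : ∀ i → restrict W f i ≤ off W i + restrict M f i
    apart i with i ∈? M
    ... | yes _ = restrict-≤ {W = W} {f = f} i
    ... | no _ = m≤m+n _ 0
    together : ∀ i → off W i + spike m (weight M f) i ≤ restrict R (merge m (weight M f) f) i
    together i with i Fin.≟ m | i ∈? M | i ∈? R | i ∈? W
    ... | yes refl | no i∉M | _ | _ = contradiction m∈M i∉M
    ... | yes refl | _ | no i∉R | _ = contradiction m∈R i∉R
    ... | yes refl | yes _ | yes _ | _ = ≤-refl
    ... | no _ | yes _ | _ | _ = z≤n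
    ... | no _ | no _ | _ | no _ = z≤n
    ... | no _ | no _ | yes _ | yes _ = ≤-reflexive (+-identityʳ (f i))
    ... | no _ | no i∉M | no i∉R | yes i∈W = contradiction (W∖M⊆R i∈W i∉M) i∉R

  weight-expand : ∀ {T T₁ T₂ : Subset n} → T₁ ⊆ M → (∀ {x} → x ∈ T₂ → x ∈ M → x ≡ m) →
    (∀ {x} → x ∈ T₂ → x ∉ M → x ∈ T) → (m ∈ T₂ → T₁ ⊆ T) → m ∈ M →
    weight T₂ (merge m (weight T₁ f) f) ≤ weight T f
  weight-expand {T} {T₁} {T₂} T₁⊆M T₂∩M T₂∖M⊆T T₁⊆T m∈M with m ∈? T₂
  ... | no m∉ = sum-mono pointwise
    where
    pointwise : ∀ i → restrict T₂ (merge m (weight T₁ f) f) i ≤ restrict T f i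
    pointwise i with i ∈? T₂
    ... | no _ = z≤n
    ... | yes i∈ with i Fin.≟ m
    ...   | yes refl = contradiction i∈ m∉
    ...   | no i≢m rewrite restrict-∈ {f = f} (T₂∖M⊆T i∈ λ i∈M → i≢m (T₂∩M i∈ i∈M)) = ≤-refl
  ... | yes m∈ = begin
    weight T₂ (merge m (weight T₁ f) f)
      ≤⟨ sum-mono apart ⟩
    sum (λ i → off T₂ i + spike m (weight T₁ f) i)
      ≡⟨ ∑-distrib-+ (off T₂) (spike m (weight T₁ f)) ⟩
    sum (off T₂) + sum (spike m (weight T₁ f))
      ≡⟨ cong (sum (off T₂) +_) (sum-spike m (weight T₁ f)) ⟩
    sum (off T₂) + weight T₁ f
      ≡⟨ ∑-distrib-+ (off T₂) (restrict T₁ f) ⟨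
    sum (λ i → off T₂ i + restrict T₁ f i)
      ≤⟨ sum-mono together ⟩
    weight T f ∎
    where
    open ≤-Reasoning
    apart : ∀ i → restrict T₂ (merge m (weight T₁ f) f) i ≤ off T₂ i + spike m (weight T₁ f) i
    apart i with i ∈? T₂
    ... | no _ = z≤n
    ... | yes i∈ with i Fin.≟ m
    ...   | yes _ = m≤n+m _ _
    ...   | no i≢m with i ∈? M
    ...     | yes i∈M = contradiction (T₂∩M i∈ i∈M) i≢m
    ...     | no _ = m≤m+n _ 0
    together : ∀ i → off T₂ i + restrict T₁ f i ≤ restrict T f i
    together i with i ∈? M
    together i | yes _ with i ∈? T₁
    ... | no _ = z≤n
    ... | yes i∈ rewrite restrict-∈ {f = f} (T₁⊆T m∈ i∈) = ≤-refl
    together i | no i∉M rewrite restrict-∉ {f = f} (i∉M ∘ T₁⊆M) | +-identityʳ (restrict T₂ f i) with i ∈? T₂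
    ... | no _ = z≤n
    ... | yes i∈ rewrite restrict-∈ {f = f} (T₂∖M⊆T i∈ i∉M) = ≤-refl

weight-rootLe : ∀ {n q A D} .{{_ : NonZero q}} (U : Subset n) {s t : Fin n → ℕ} →
  (∀ {x} → x ∈ U → RootLe q A D (s x) (t x)) → RootLe q A D (weight U s) (weight U t)
weight-rootLe [] h = rootLe-zero
weight-rootLe (true ∷ U) h = rootLe-add (h here) (weight-rootLe U (h ∘ there))
weight-rootLe (false ∷ U) h = weight-rootLe U (h ∘ there)

module _ {n : ℕ} (W : Subset n) {v : Fin n} (v∈W : v ∈ W) (s t : Fin n → ℕ) (τ : ℕ)
  (heaviest : ∀ {x} → x ∈ W → t x ≤ t v)
  (pair : ∀ {x} → x ∈ W → x ≢ v → t x + t v ≤ τ)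
  (cover : weight W t + t v ≤ 2 * τ) (tv≤τ : t v ≤ τ) where

  private
    others? : Decidable (λ x → x ∈ W × x ≢ v)
    others? x = (x ∈? W) ×-dec ¬? (x Fin.≟ v)

    others : Subset n
    others = ⟪ others? ⟫

    splitW : ∀ f → weight others f + f v ≡ weight W f
    splitW f = weight-split v∈W (λ v∈ → proj₂ (∈⟪⟫⁻ others? v∈) refl) (λ x∈ → proj₁ (∈⟪⟫⁻ others? x∈))
      (λ x∈ x≢v → ∈⟪⟫⁺ others? (x∈ , x≢v))

    bounded : ∀ r q → (∀ {x} → x ∈ W → s x ^ q ≤ t x ^ q * t x ^ r) →
      ∀ {x c} → x ∈ W → t x ≤ c → RootLe q 1 (c ^ r) (s x) (t x)
    bounded r q roots {x} x∈ tx≤c = rootLe (≤-trans (≤-reflexive (*-identityʳ _))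
      (≤-trans (roots x∈) (*-monoʳ-≤ (t x ^ q) (^-monoˡ-≤ r tx≤c))))

  -- If `2 * t v ≤ τ`, each size is at most its weight times t(v)^(r/q), and the total weight is at
  -- most 2τ - t(v). Otherwise let d be τ - t(v): by `pair` every other weight is at most d, and by
  -- `cover` these weights add up to at most 2d.
  weightBound : ∀ r k .{{_ : NonZero (r + k)}} → 3 ^ (r + k) ≤ 2 ^ (r + k) * 2 ^ r →
    (∀ {x} → x ∈ W → s x ^ (r + k) ≤ t x ^ (r + k) * t x ^ r) →
    RootLe (r + k) 1 (τ ^ r) (weight W s) τ
  weightBound r k 3^q≤2^p roots with ≤-total (2 * t v) τ
  ... | inj₁ light = lightBound r k 3^q≤2^p light cover
    (weight-rootLe W λ x∈ → bounded r (r + k) roots x∈ (heaviest x∈))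
  ... | inj₂ heavy = subst₂ (λ w S → RootLe (r + k) 1 (w ^ r) S w) a+d≡τ
    (trans (+-comm (s v) (weight others s)) (splitW s))
    (heavyBound r k 3^q≤2^p d≤a (bounded r (r + k) roots v∈W ≤-refl)
      (rootLe-mono ≤-refl rest≤2d (weight-rootLe others λ x∈ →
        let (x∈W , x≢v) = ∈⟪⟫⁻ others? x∈ in bounded r (r + k) roots x∈W (rest≤d x∈W x≢v))))
    where
    a = t v
    d = τ ∸ a
    a+d≡τ : a + d ≡ τ
    a+d≡τ = m+[n∸m]≡n tv≤τ
    d≤a : d ≤ a
    d≤a = +-cancelˡ-≤ a _ _ (≤-trans (≤-reflexive a+d≡τ) (≤-trans heavy (≤-reflexive (cong (a +_) (+-identityʳ a)))))
    rest≤d : ∀ {x} → x ∈ W → x ≢ v → t x ≤ d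
    rest≤d {x} x∈ x≢v = +-cancelʳ-≤ a _ _ (≤-trans (pair x∈ x≢v) (≤-reflexive (trans (sym a+d≡τ) (+-comm a d))))
    rest≤2d : weight others t ≤ 2 * d
    rest≤2d = +-cancelʳ-≤ (2 * a) _ _ (≤-trans (≤-reflexive
      (trans (lhs (weight others t) a) (cong (_+ a) (splitW t))))
      (≤-trans cover (≤-reflexive (trans (cong (2 *_) (sym a+d≡τ)) (rhs a d)))))
      where
      lhs : ∀ w a → w + 2 * a ≡ w + a + a
      lhs = solve-∀
      rhs : ∀ a d → 2 * (a + d) ≡ 2 * d + 2 * a
      rhs = solve-∀

  weightRoot : (∀ {x} → x ∈ W → AtLeastRoot (s x) (t x)) → AtLeastRoot (weight W s) τ
  weightRoot roots p q 3^q≤2^p with ≤-total p (2 * suc q)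
  -- For γ = p/(q + 1) ≤ 2 the choice r = p - (q + 1) and k = (q + 1) - r gives γ = 1 + r/(r + k).
  ... | inj₁ p≤2q = small (p ∸ suc q) (suc q ∸ (p ∸ suc q)) (m+[n∸m]≡n r≤q) (m+[n∸m]≡n q≤p)
    where
    q≤p : suc q ≤ p
    q≤p = ≮⇒≥ λ p<q → <⇒≱ (<-≤-trans (^-monoʳ-< 2 (s≤s (s≤s z≤n)) p<q) (^-monoˡ-≤ (suc q) (n≤1+n 2))) 3^q≤2^p
    r≤q : p ∸ suc q ≤ suc q
    r≤q = ≤-trans (∸-monoˡ-≤ (suc q) p≤2q) (≤-reflexive (trans (cong (_∸ suc q) (cong (suc q +_) (+-identityʳ (suc q)))) (m+n∸m≡n (suc q) (suc q))))
    small : ∀ r k → r + k ≡ suc q → suc q + r ≡ p → weight W s ^ suc q ≤ τ ^ p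
    small r k r+k≡q refl = subst (λ z → weight W s ^ z ≤ τ ^ (z + r)) r+k≡q
      (≤-trans (≤-reflexive (sym (*-identityʳ _)))
        (≤-trans (RootLe.powers (weightBound r k {{subst NonZero (sym r+k≡q) _}}
          (subst (λ z → 3 ^ z ≤ 2 ^ z * 2 ^ r) (sym r+k≡q) (≤-trans 3^q≤2^p (≤-reflexive (^-distribˡ-+-* 2 (suc q) r))))
          (λ {x} x∈ → subst (λ z → s x ^ z ≤ t x ^ z * t x ^ r) (sym r+k≡q)
            (≤-trans (roots x∈ (suc q + r) q 3^q≤2^p) (≤-reflexive (^-distribˡ-+-* (t x) (suc q) r))))))
          (≤-reflexive (sym (^-distribˡ-+-* τ (r + k) r)))))
  -- The exponent γ = 2 implies all larger ones.
  ... | inj₂ 2q≤p = large τ (subst₂ _≤_ (trans (*-identityʳ _) (^-identityʳ _)) refl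
      (RootLe.powers (weightBound 1 0 3≤4 λ {x} x∈ → ≤-trans (roots x∈ 2 0 3≤4) (≤-reflexive (sq (t x))))))
    where
    3≤4 : 3 ≤ 4
    3≤4 = s≤s (s≤s (s≤s z≤n))
    sq : ∀ a → a * (a * 1) ≡ a * 1 * (a * 1)
    sq = solve-∀
    large : ∀ τ → weight W s ≤ τ ^ 1 * τ ^ 1 → weight W s ^ suc q ≤ τ ^ p
    large zero le rewrite n≤0⇒n≡0 le = z≤n
    large τ@(suc _) le = ≤-trans (^-monoˡ-≤ (suc q) (≤-trans le (≤-reflexive (sym (sq τ)))))
      (≤-trans (≤-reflexive (^-*-assoc τ 2 (suc q))) (^-monoʳ-≤ τ 2q≤p))

atLeastRoot-mono : ∀ {n n′ k k′} → n′ ≤ n → k ≤ k′ → AtLeastRoot n k → AtLeastRoot n′ k′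
atLeastRoot-mono n′≤n k≤k′ h p q 3^q≤2^p =
  ≤-trans (^-monoˡ-≤ (suc q) n′≤n) (≤-trans (h p q 3^q≤2^p) (^-monoˡ-≤ p k≤k′))

module _ {n : ℕ} (G : Tournament n) where

  private
    _⇒_ = _⟶_ G

  except : Fin n → (Fin n → ℕ) → Fin n → ℕ
  except v f x = if does (x Fin.≟ v) then 0 else f x

  -- For the second heaviest vertex `u` the weight of `v` is set to zero, so a maximum exists even
  -- if `W` has only one vertex. If that maximum is at `v`, the weight of `x` is zero and `v` alone
  -- gives the bound.
  pair-except : ∀ {f : Fin n → ℕ} {u v x} → x ≢ v → except v f x ≤ except v f u →
    f x + f v ≤ weight (⁅ v ⁆ ∪ ⁅ u ⁆) f
  pair-except {f} {u} {v} {x} x≢v x≤u with x Fin.≟ v | u Fin.≟ v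
  ... | yes x≡v | _ = contradiction x≡v x≢v
  ... | no _ | yes refl rewrite n≤0⇒n≡0 x≤u = weight-point (x∈p∪q⁺ (inj₁ (x∈⁅x⁆ v)))
  ... | no _ | no u≢v = ≤-trans (+-monoˡ-≤ (f v) x≤u)
    (weight-pair {f = f} (x∈p∪q⁺ (inj₂ (x∈⁅x⁆ u))) (x∈p∪q⁺ (inj₁ (x∈⁅x⁆ v))) u≢v)

  LargeAcyclic : Subset n → (s t : Fin n → ℕ) → Set
  LargeAcyclic W s t = Σ (Subset n) λ T → T ⊆ W × Acyclic G T × AtLeastRoot (weight W s) (weight T t)

  heaviestOf : ∀ {W} {w : Subset n → ℕ} (A B : Subset n) → A ⊆ W → B ⊆ W → Acyclic G A → Acyclic G B →
    Σ (Subset n) λ C → C ⊆ W × Acyclic G C × w A ≤ w C × w B ≤ w C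
  heaviestOf {w = w} A B A⊆W B⊆W acyclicA acyclicB with ≤-total (w A) (w B)
  ... | inj₁ A≤B = B , B⊆W , acyclicB , A≤B , ≤-refl
  ... | inj₂ B≤A = A , A⊆W , acyclicA , ≤-refl , B≤A

  module _ (u5-free : NoU5 G) where

    -- It suffices to let three acyclic sets compete for `T`: the two sets of the cover and the pair
    -- of heaviest vertices. They supply the bounds that `weightRoot` asks of τ.
    primeCase : ∀ {W} {s t : Fin n → ℕ} → Prime G W → (∀ {x} → x ∈ W → AtLeastRoot (s x) (t x)) →
      ∃ (_∈ W) → LargeAcyclic W s t
    primeCase {W} {s} {t} prime roots inhabited with argmax (_∈? W) t inhabited
    ... | v , v∈W , heaviest with argmax (_∈? W) (except v t) inhabited
    ...   | u , u∈W , second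
      with heaviestOf {w = λ T → weight T t} P Q P⊆W Q⊆W acyclicP acyclicQ
      where open Cover (primeCover G u5-free prime v∈W)
    ...     | A , A⊆W , acyclicA , P≤A , Q≤A
      with heaviestOf {w = λ T → weight T t} A (⁅ v ⁆ ∪ ⁅ u ⁆) A⊆W pair⊆W acyclicA acyclicPair
      where
      ∈pair : ∀ {x} → x ∈ ⁅ v ⁆ ∪ ⁅ u ⁆ → x ≡ v ⊎ x ≡ u
      ∈pair x∈ with x∈p∪q⁻ ⁅ v ⁆ ⁅ u ⁆ x∈
      ... | inj₁ x∈v = inj₁ (x∈⁅y⁆⇒x≡y v x∈v)
      ... | inj₂ x∈u = inj₂ (x∈⁅y⁆⇒x≡y u x∈u)
      pair⊆W : ⁅ v ⁆ ∪ ⁅ u ⁆ ⊆ W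
      pair⊆W x∈ with ∈pair x∈
      ... | inj₁ refl = v∈W
      ... | inj₂ refl = u∈W
      acyclicPair : Acyclic G (⁅ v ⁆ ∪ ⁅ u ⁆)
      acyclicPair x∈ y∈ z∈ x⇒y y⇒z z⇒x with ∈pair x∈ | ∈pair y∈ | ∈pair z∈
      ... | inj₁ refl | inj₁ refl | _ = loopless G _ x⇒y
      ... | inj₂ refl | inj₂ refl | _ = loopless G _ x⇒y
      ... | _ | inj₁ refl | inj₁ refl = loopless G _ y⇒z
      ... | _ | inj₂ refl | inj₂ refl = loopless G _ y⇒z
      ... | inj₁ refl | _ | inj₁ refl = loopless G _ z⇒x
      ... | inj₂ refl | _ | inj₂ refl = loopless G _ z⇒x
    ...       | T , T⊆W , acyclicT , A≤T , pair≤T = T , T⊆W , acyclicT ,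
      weightRoot W v∈W s t (weight T t) heaviest pair covered (≤-trans (weight-point v∈P) P≤T) roots
      where
      open Cover (primeCover G u5-free prime v∈W)
      P≤T : weight P t ≤ weight T t
      P≤T = ≤-trans P≤A A≤T
      covered : weight W t + t v ≤ 2 * weight T t
      covered = ≤-trans (weight-cover {f = t} v∈P v∈Q cover)
        (+-mono-≤ P≤T (≤-trans (≤-trans Q≤A A≤T) (≤-reflexive (sym (+-identityʳ _)))))
      pair : ∀ {x} → x ∈ W → x ≢ v → t x + t v ≤ weight T t
      pair {x} x∈ x≢v = ≤-trans (pair-except {f = t} x≢v (second x∈)) pair≤T

    -- Induction on the size of `W`. A nontrivial module `M` is solved first and contracted to `m`,
    -- with size `weight M s` and weight `weight T₁ t`; the bound found for `M` is then the
    -- hypothesis on roots at `m`. This is why sizes and weights are separate functions.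
    largeAcyclic : ∀ k {W} {s t : Fin n → ℕ} → ∣ W ∣ < k → (∀ {x} → x ∈ W → AtLeastRoot (s x) (t x)) →
      LargeAcyclic W s t
    largeAcyclic (suc k) {W} {s} {t} (s≤s ∣W∣≤k) roots with nonempty? W
    ... | no empty = ∅ , (λ x∈ → contradiction x∈ ∉⊥) , (λ x∈ → contradiction x∈ ∉⊥) ,
      λ p q _ → ≤-trans (^-monoˡ-≤ (suc q) weightless) z≤n
      where
      weightless : weight W s ≤ 0
      weightless = ≤-trans (sum-mono {g = const 0} λ i → ≤-reflexive (restrict-∉ {f = s} λ i∈ → empty (i , i∈)))
        (≤-reflexive (sum-replicate-zero n))
    ... | yes inhabited with anySubset? (λ M → isModule? G W M
             ×-dec Fin.any? (λ x → (x ∈? M) ×-dec Fin.any? (λ y → (y ∈? M) ×-dec ¬? (y Fin.≟ x)))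
             ×-dec Fin.any? (λ z → (z ∈? W) ×-dec ¬? (z ∈? M)))
    ...   | no none = primeCase prime roots inhabited
      where
      prime : Prime G W
      prime {M} isM {x} {y} x∈ y∈ x≢y {z} z∈W with z ∈? M
      ... | yes z∈M = z∈M
      ... | no z∉M = contradiction (M , isM , (x , x∈ , y , y∈ , x≢y ∘ sym) , (z , z∈W , z∉M)) none
    ...   | yes (M , isM , (m , m∈M , y , y∈M , y≢m) , (z , z∈W , z∉M))
      with largeAcyclic k {M} {s} {t} (<-≤-trans (p⊂q⇒∣p∣<∣q∣ (IsModule.⊆W isM , z , z∈W , z∉M)) ∣W∣≤k)
             (roots ∘ IsModule.⊆W isM)
    ...     | T₁ , T₁⊆M , acyclic₁ , root₁
      with largeAcyclic k {rest G isM m∈M} {merge m (weight M s) s} {merge m (weight T₁ t) t}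
             (<-≤-trans (p⊂q⇒∣p∣<∣q∣ (rest⊆W G isM m∈M , y , IsModule.⊆W isM y∈M
               , λ y∈ → y≢m (rest∩M G isM m∈M y∈ y∈M))) ∣W∣≤k) merged
      where
      merged : ∀ {x} → x ∈ rest G isM m∈M → AtLeastRoot (merge m (weight M s) s x) (merge m (weight T₁ t) t x)
      merged {x} x∈ with x Fin.≟ m
      ... | yes _ = root₁
      ... | no _ = roots (rest⊆W G isM m∈M x∈)
    ...       | T₂ , T₂⊆ , acyclic₂ , root₂ = ⟪ T? ⟫ , T⊆W , acyclicT ,
      atLeastRoot-mono (weight-contract {f = s} m∈M (v∈rest G isM m∈M) (∈rest G isM m∈M))
        (weight-expand {f = t} T₁⊆M (λ x∈ x∈M → rest∩M G isM m∈M (T₂⊆ x∈) x∈M)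
          (λ x∈ x∉M → ∈⟪⟫⁺ T? (inj₁ (x∈ , x∉M))) (λ m∈ x∈ → ∈⟪⟫⁺ T? (inj₂ (m∈ , x∈))) m∈M) root₂
      where
      open IsModule isM
      T? : Decidable (λ x → (x ∈ T₂ × x ∉ M) ⊎ (m ∈ T₂ × x ∈ T₁))
      T? x = ((x ∈? T₂) ×-dec ¬? (x ∈? M)) ⊎-dec ((m ∈? T₂) ×-dec (x ∈? T₁))
      T⊆W : ⟪ T? ⟫ ⊆ W
      T⊆W x∈ with ∈⟪⟫⁻ T? x∈
      ... | inj₁ (x∈₂ , _) = rest⊆W G isM m∈M (T₂⊆ x∈₂)
      ... | inj₂ (_ , x∈₁) = ⊆W (T₁⊆M x∈₁)
      acyclicT : Acyclic G ⟪ T? ⟫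
      acyclicT = acyclic-glue G isM m∈M T⊆W in₁ in₂ acyclic₁ acyclic₂
        where
        in₁ : ∀ {x} → x ∈ ⟪ T? ⟫ → x ∈ M → x ∈ T₁ × m ∈ T₂
        in₁ x∈ x∈M with ∈⟪⟫⁻ T? x∈
        ... | inj₁ (_ , x∉M) = contradiction x∈M x∉M
        ... | inj₂ (m∈₂ , x∈₁) = x∈₁ , m∈₂
        in₂ : ∀ {x} → x ∈ ⟪ T? ⟫ → x ∉ M → x ∈ T₂
        in₂ x∈ x∉M with ∈⟪⟫⁻ T? x∈
        ... | inj₁ (x∈₂ , _) = x∈₂
        ... | inj₂ (_ , x∈₁) = contradiction (T₁⊆M x∈₁) x∉M

-- Translation between embeddings and subsets

u5-total : ∀ i j → i ≡ j ⊎ u5 i j ≡ true ⊎ u5 j i ≡ true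
u5-total = toWitness {a? = Fin.all? λ i → Fin.all? λ j →
  (i Fin.≟ j) ⊎-dec ((u5 i j Bool.≟ true) ⊎-dec (u5 j i Bool.≟ true))} tt

-- Injectivity and the reflection of edges both follow from the preservation of edges, because any
-- two distinct vertices of U₅ are joined (`u5-total`).
noU5 : ∀ {n} (G : Tournament n) → U5Free G → NoU5 G
noU5 {n} G free {v₁} {v₂} {v₃} {v₄} {v₅} e₂₁ e₁₃ e₂₃ e₂₄ e₃₄ e₃₅ e₄₅ e₄₁ e₅₁ e₅₂ =
  free (f , injective , λ i j → reflects i j , edge i j)
  where
  f : Fin 5 → Fin n
  f = lookup (v₁ ∷ v₂ ∷ v₃ ∷ v₄ ∷ v₅ ∷ [])
  edge : ∀ i j → u5 i j ≡ true → _⟶_ G (f i) (f j)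
  edge 1F 0F _ = e₂₁
  edge 0F 2F _ = e₁₃
  edge 1F 2F _ = e₂₃
  edge 1F 3F _ = e₂₄
  edge 2F 3F _ = e₃₄
  edge 2F 4F _ = e₃₅
  edge 3F 4F _ = e₄₅
  edge 3F 0F _ = e₄₁
  edge 4F 0F _ = e₅₁
  edge 4F 1F _ = e₅₂
  edge 0F 3F ()
  edge 0F 4F ()
  edge 1F 4F ()
  edge 4F 2F ()
  edge 4F 3F ()
  edge 4F 4F ()
  injective : Injective _≡_ _≡_ f
  injective {i} {j} fi≡fj with u5-total i j
  ... | inj₁ i≡j = i≡j
  ... | inj₂ (inj₁ ij) = ⊥-elim (loopless G (f j) (subst (λ x → _⟶_ G x (f j)) fi≡fj (edge i j ij)))
  ... | inj₂ (inj₂ ji) = ⊥-elim (loopless G (f j) (subst (_⟶_ G (f j)) fi≡fj (edge j i ji)))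
  reflects : ∀ i j → _⟶_ G (f i) (f j) → u5 i j ≡ true
  reflects i j fi⟶fj with u5-total i j
  ... | inj₁ refl = ⊥-elim (loopless G (f i) fi⟶fj)
  ... | inj₂ (inj₁ ij) = ij
  ... | inj₂ (inj₂ ji) = ⊥-elim (asym G fi⟶fj (edge j i ji))

enum : ∀ {n} (T : Subset n) → Fin ∣ T ∣ → Fin n
enum (true ∷ T) zero = zero
enum (true ∷ T) (suc i) = suc (enum T i)
enum (false ∷ T) i = suc (enum T i)

enum∈ : ∀ {n} (T : Subset n) i → enum T i ∈ T
enum∈ (true ∷ T) zero = here
enum∈ (true ∷ T) (suc i) = there (enum∈ T i)
enum∈ (false ∷ T) i = there (enum∈ T i)

enum-injective : ∀ {n} (T : Subset n) → Injective _≡_ _≡_ (enum T)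
enum-injective (true ∷ T) {zero} {zero} _ = refl
enum-injective (true ∷ T) {suc i} {suc j} eq = cong suc (enum-injective T (Fin.suc-injective eq))
enum-injective (false ∷ T) eq = enum-injective T (Fin.suc-injective eq)

transitiveSubtournament : (n : ℕ) (G : Tournament n) → U5Free G →
  Σ ℕ λ m → Σ (Fin m → Fin n) λ f → Injective _≡_ _≡_ f × TransitiveOn G f × AtLeastRoot n m
transitiveSubtournament n G free
  with largeAcyclic G (noU5 G free) (suc n) {⊤} {const 1} {const 1} (s≤s (≤-reflexive (∣⊤∣≡n n)))
         (λ _ p q _ → ≤-reflexive (trans (^-zeroˡ (suc q)) (sym (^-zeroˡ p))))
... | T , _ , acyclic , root = ∣ T ∣ , enum T , enum-injective T
  , (λ a b c (ab , bc , ca) → acyclic (enum∈ T a) (enum∈ T b) (enum∈ T c) ab bc ca)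
  , subst₂ AtLeastRoot (trans (weight-1 {n} ⊤) (∣⊤∣≡n n)) (weight-1 T) root

-- Powers of the cyclic triangle

remQuot-injective : ∀ {m n} {x y : Fin (m * n)} → remQuot {m} n x ≡ remQuot {m} n y → x ≡ y
remQuot-injective {m} {n} {x} {y} eq = trans (sym (Fin.combine-remQuot {m} n x))
  (trans (cong (λ (i , j) → combine i j) eq) (Fin.combine-remQuot {m} n y))

lex : ∀ {m n} → Tournament m → Tournament n → Tournament (m * n)
lex {m} {n} G H = record
  { _⟶_ = λ x y → _⟶_ G (hi x) (hi y) ⊎ (hi x ≡ hi y × _⟶_ H (lo x) (lo y))
  ; loopless = λ { u (inj₁ e) → loopless G _ e ; u (inj₂ (_ , e)) → loopless H _ e }
  ; oneEdge = one
  }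
  where
  hi : Fin (m * n) → Fin m
  hi x = proj₁ (remQuot {m} n x)
  lo : Fin (m * n) → Fin n
  lo x = proj₂ (remQuot {m} n x)
  one : ∀ u v → u ≢ v → _
  one u v u≢v with hi u Fin.≟ hi v
  ... | no hi≢ with oneEdge G (hi u) (hi v) hi≢
  ...   | inj₁ (e , ¬e) = inj₁ (inj₁ e , λ { (inj₁ e′) → ¬e e′ ; (inj₂ (eq , _)) → hi≢ (sym eq) })
  ...   | inj₂ (e , ¬e) = inj₂ (inj₁ e , λ { (inj₁ e′) → ¬e e′ ; (inj₂ (eq , _)) → hi≢ eq })
  one u v u≢v | yes hi≡ with oneEdge H (lo u) (lo v) (u≢v ∘ λ lo≡ → remQuot-injective (cong₂ _,_ hi≡ lo≡))
  ... | inj₁ (e , ¬e) = inj₁ (inj₂ (hi≡ , e) ,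
    λ { (inj₁ e′) → loopless G _ (subst (_⟶_ G (hi v)) hi≡ e′) ; (inj₂ (_ , e′)) → ¬e e′ })
  ... | inj₂ (e , ¬e) = inj₂ (inj₂ (sym hi≡ , e) ,
    λ { (inj₁ e′) → loopless G _ (subst (λ x → _⟶_ G x (hi v)) hi≡ e′) ; (inj₂ (_ , e′)) → ¬e e′ })

data Cyc : Fin 3 → Fin 3 → Set where
  c₀₁ : Cyc 0F 1F
  c₁₂ : Cyc 1F 2F
  c₂₀ : Cyc 2F 0F

C₃ : Tournament 3
C₃ = record { _⟶_ = Cyc ; loopless = λ _ () ; oneEdge = one }
  where
  one : ∀ u v → u ≢ v → (Cyc u v × ¬ Cyc v u) ⊎ (Cyc v u × ¬ Cyc u v)
  one 0F 0F u≢v = contradiction refl u≢v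
  one 0F 1F _ = inj₁ (c₀₁ , λ ())
  one 0F 2F _ = inj₂ (c₂₀ , λ ())
  one 1F 0F _ = inj₂ (c₀₁ , λ ())
  one 1F 1F u≢v = contradiction refl u≢v
  one 1F 2F _ = inj₁ (c₁₂ , λ ())
  one 2F 0F _ = inj₁ (c₂₀ , λ ())
  one 2F 1F _ = inj₂ (c₁₂ , λ ())
  one 2F 2F u≢v = contradiction refl u≢v

Cyc-functional : ∀ {x y y′} → Cyc x y → Cyc x y′ → y ≡ y′
Cyc-functional c₀₁ c₀₁ = refl
Cyc-functional c₁₂ c₁₂ = refl
Cyc-functional c₂₀ c₂₀ = refl

_≲_ : Fin 3 → Fin 3 → Set
x ≲ y = x ≡ y ⊎ Cyc x y

≲-triangle : ∀ {x y z} → x ≲ y → y ≲ z → z ≲ x → (x ≡ y × y ≡ z) ⊎ (Cyc x y × Cyc y z × Cyc z x)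
≲-triangle (inj₁ refl) (inj₁ refl) _ = inj₁ (refl , refl)
≲-triangle (inj₁ refl) (inj₂ yz) (inj₁ refl) = ⊥-elim (loopless C₃ _ yz)
≲-triangle (inj₁ refl) (inj₂ yz) (inj₂ zx) = ⊥-elim (asym C₃ yz zx)
≲-triangle (inj₂ xy) (inj₁ refl) (inj₁ refl) = ⊥-elim (loopless C₃ _ xy)
≲-triangle (inj₂ xy) (inj₁ refl) (inj₂ zx) = ⊥-elim (asym C₃ xy zx)
≲-triangle (inj₂ xy) (inj₂ yz) (inj₁ refl) = ⊥-elim (asym C₃ xy yz)
≲-triangle (inj₂ xy) (inj₂ yz) (inj₂ zx) = inj₂ (xy , yz , zx)

-- The fibres of a weak homomorphism from U₅ to C₃ would be modules of U₅, which is prime.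
-- The cyclic triangles of U₅ are 134, 135, 235 and 245.
weakHom-constant : ∀ {a b c d e} → a ≲ c → b ≲ c → b ≲ d → c ≲ d → c ≲ e → d ≲ e → d ≲ a → e ≲ a → e ≲ b →
  a ≡ b × a ≡ c × a ≡ d × a ≡ e
weakHom-constant ac bc bd cd ce de da ea eb
  with ≲-triangle ac cd da | ≲-triangle ac ce ea | ≲-triangle bc ce eb
... | inj₁ (refl , refl) | inj₁ (refl , refl) | inj₁ (refl , refl) = refl , refl , refl , refl
... | inj₁ (refl , refl) | inj₁ (refl , refl) | inj₂ (_ , cc , _) = ⊥-elim (loopless C₃ _ cc)
... | inj₁ (refl , refl) | inj₂ (cc , _) | _ = ⊥-elim (loopless C₃ _ cc)
... | inj₂ (cc , _) | inj₁ (refl , refl) | _ = ⊥-elim (loopless C₃ _ cc)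
... | inj₂ _ | inj₂ (_ , cc , _) | inj₁ (refl , refl) = ⊥-elim (loopless C₃ _ cc)
... | inj₂ (_ , c⟶d , _) | inj₂ (_ , c⟶e , _) | inj₂ (b⟶c , _ , e⟶b)
  with refl ← Cyc-functional c⟶d c⟶e with ≲-triangle bd de eb
...   | inj₁ (refl , _) = ⊥-elim (loopless C₃ _ e⟶b)
...   | inj₂ (_ , dd , _) = ⊥-elim (loopless C₃ _ dd)

-- The first coordinate sends each edge of U₅ to an edge of `C₃` or to a single vertex, so it is
-- constant by `weakHom-constant`, and the U₅ lies within one copy of `G`.
lexU5Free : ∀ {n} (G : Tournament n) → U5Free G → U5Free (lex C₃ G)
lexU5Free {n} G free (f , f-injective , f-edge) = free (lo , lo-injective , λ i j → reflects i j , preserves i j)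
  where
  hi : Fin 5 → Fin 3
  hi i = proj₁ (remQuot {3} n (f i))
  lo : Fin 5 → Fin n
  lo i = proj₂ (remQuot {3} n (f i))
  weak : ∀ i j → u5 i j ≡ true → hi i ≡ hi j ⊎ Cyc (hi i) (hi j)
  weak i j ij with proj₂ (f-edge i j) ij
  ... | inj₁ c = inj₂ c
  ... | inj₂ (eq , _) = inj₁ eq
  constant : ∀ i → hi 0F ≡ hi i
  constant with weakHom-constant
    (weak 0F 2F refl) (weak 1F 2F refl) (weak 1F 3F refl) (weak 2F 3F refl)
    (weak 2F 4F refl) (weak 3F 4F refl) (weak 3F 0F refl) (weak 4F 0F refl) (weak 4F 1F refl)
  ... | e₁ , e₂ , e₃ , e₄ = λ { 0F → refl ; 1F → e₁ ; 2F → e₂ ; 3F → e₃ ; 4F → e₄ }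
  hi≡ : ∀ i j → hi i ≡ hi j
  hi≡ i j = trans (sym (constant i)) (constant j)
  lo-injective : Injective _≡_ _≡_ lo
  lo-injective {i} {j} lo≡ = f-injective (remQuot-injective (cong₂ _,_ (hi≡ i j) lo≡))
  preserves : ∀ i j → u5 i j ≡ true → _⟶_ G (lo i) (lo j)
  preserves i j ij with proj₂ (f-edge i j) ij
  ... | inj₁ c = ⊥-elim (loopless C₃ (hi j) (subst (λ x → Cyc x (hi j)) (hi≡ i j) c))
  ... | inj₂ (_ , e) = e
  reflects : ∀ i j → _⟶_ G (lo i) (lo j) → u5 i j ≡ true
  reflects i j e = proj₁ (f-edge i j) (inj₂ (hi≡ i j , e))

weight-∪ : ∀ {n} {W P Q : Subset n} (f : Fin n → ℕ) → (∀ {x} → x ∈ W → x ∈ P ⊎ x ∈ Q) →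
  weight W f ≤ weight P f + weight Q f
weight-∪ {W = W} {P} {Q} f cover =
  subst (weight W f ≤_) (∑-distrib-+ (restrict P f) (restrict Q f)) (sum-mono pointwise)
  where
  pointwise : ∀ i → restrict W f i ≤ restrict P f i + restrict Q f i
  pointwise i with i ∈? W
  ... | no _ = z≤n
  ... | yes i∈ with cover i∈
  ...   | inj₁ i∈P rewrite restrict-∈ {f = f} i∈P = m≤m+n (f i) _
  ...   | inj₂ i∈Q rewrite restrict-∈ {f = f} i∈Q = m≤n+m (f i) _

-- Vertices from all three copies of `G` would form a cyclic triangle, so at most two copies are
-- met, each in at most `b` vertices.
lexTransitive : ∀ {n} (G : Tournament n) {b} →
  (∀ {m} (f : Fin m → Fin n) → Injective _≡_ _≡_ f → TransitiveOn G f → m ≤ b) →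
  ∀ {m} (f : Fin m → Fin (3 * n)) → Injective _≡_ _≡_ f → TransitiveOn (lex C₃ G) f → m ≤ 2 * b
lexTransitive {n} G {b} bound {m} f f-injective transitive =
  cases (Fin.any? λ i → hi i Fin.≟ 0F) (Fin.any? λ i → hi i Fin.≟ 1F) (Fin.any? λ i → hi i Fin.≟ 2F)
  where
  hi : Fin m → Fin 3
  hi i = proj₁ (remQuot {3} n (f i))
  lo : Fin m → Fin n
  lo i = proj₂ (remQuot {3} n (f i))
  fibre? : ∀ c → Decidable (λ i → hi i ≡ c)
  fibre? c i = hi i Fin.≟ c
  fibre : Fin 3 → Subset m
  fibre c = ⟪ fibre? c ⟫
  hi-enum : ∀ c i → hi (enum (fibre c) i) ≡ c
  hi-enum c i = ∈⟪⟫⁻ (fibre? c) (enum∈ (fibre c) i)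
  fibre≤ : ∀ c → ∣ fibre c ∣ ≤ b
  fibre≤ c = bound (lo ∘ enum (fibre c)) lo-injective λ i j k (ij , jk , ki) →
    transitive _ _ _ (inj₂ (hi≡ i j , ij) , inj₂ (hi≡ j k , jk) , inj₂ (hi≡ k i , ki))
    where
    hi≡ : ∀ i j → hi (enum (fibre c) i) ≡ hi (enum (fibre c) j)
    hi≡ i j = trans (hi-enum c i) (sym (hi-enum c j))
    lo-injective : Injective _≡_ _≡_ (lo ∘ enum (fibre c))
    lo-injective {i} {j} lo≡ =
      enum-injective (fibre c) (f-injective (remQuot-injective (cong₂ _,_ (hi≡ i j) lo≡)))
  twoFibres : ∀ c d → (∀ i → hi i ≡ c ⊎ hi i ≡ d) → m ≤ 2 * b
  twoFibres c d covered = begin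
    m ≡⟨ trans (weight-1 {m} ⊤) (∣⊤∣≡n m) ⟨
    weight {m} ⊤ (const 1) ≤⟨ weight-∪ (const 1) (λ {i} _ → [ inj₁ ∘ ∈⟪⟫⁺ (fibre? c) , inj₂ ∘ ∈⟪⟫⁺ (fibre? d) ]′ (covered i)) ⟩
    weight (fibre c) (const 1) + weight (fibre d) (const 1) ≡⟨ cong₂ _+_ (weight-1 (fibre c)) (weight-1 (fibre d)) ⟩
    ∣ fibre c ∣ + ∣ fibre d ∣ ≤⟨ +-mono-≤ (fibre≤ c) (≤-trans (fibre≤ d) (≤-reflexive (sym (+-identityʳ b)))) ⟩
    2 * b ∎
    where open ≤-Reasoning
  avoid : ∀ {c d e} → (∀ x → x ≡ e ⊎ (x ≡ c ⊎ x ≡ d)) → ¬ (∃ λ i → hi i ≡ e) → ∀ i → hi i ≡ c ⊎ hi i ≡ d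
  avoid exhaust none i with exhaust (hi i)
  ... | inj₁ eq = contradiction (i , eq) none
  ... | inj₂ other = other
  cases : Dec (∃ λ i → hi i ≡ 0F) → Dec (∃ λ i → hi i ≡ 1F) → Dec (∃ λ i → hi i ≡ 2F) → m ≤ 2 * b
  cases (no none) _ _ = twoFibres 1F 2F (avoid (λ { 0F → inj₁ refl ; 1F → inj₂ (inj₁ refl) ; 2F → inj₂ (inj₂ refl) }) none)
  cases _ (no none) _ = twoFibres 0F 2F (avoid (λ { 0F → inj₂ (inj₁ refl) ; 1F → inj₁ refl ; 2F → inj₂ (inj₂ refl) }) none)
  cases _ _ (no none) = twoFibres 0F 1F (avoid (λ { 0F → inj₂ (inj₁ refl) ; 1F → inj₂ (inj₂ refl) ; 2F → inj₁ refl }) none)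
  cases (yes (i , hi≡0)) (yes (j , hi≡1)) (yes (k , hi≡2)) = ⊥-elim (transitive i j k
    (inj₁ (subst₂ Cyc (sym hi≡0) (sym hi≡1) c₀₁) , inj₁ (subst₂ Cyc (sym hi≡1) (sym hi≡2) c₁₂)
    , inj₁ (subst₂ Cyc (sym hi≡2) (sym hi≡0) c₂₀)))

iterC₃ : ∀ k → Tournament (3 ^ k)
iterC₃ zero = record
  { _⟶_ = λ _ _ → ⊥ ; loopless = λ _ () ; oneEdge = λ { zero zero u≢v → contradiction refl u≢v } }
iterC₃ (suc k) = lex C₃ (iterC₃ k)

iterC₃-U5Free : ∀ k → U5Free (iterC₃ k)
iterC₃-U5Free zero (f , _ , f-edge) = proj₂ (f-edge 1F 0F) refl
iterC₃-U5Free (suc k) = lexU5Free (iterC₃ k) (iterC₃-U5Free k)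

iterC₃-transitive : ∀ k {m} (f : Fin m → Fin (3 ^ k)) → Injective _≡_ _≡_ f → TransitiveOn (iterC₃ k) f →
  m ≤ 2 ^ k
iterC₃-transitive zero f f-injective _ = Fin.injective⇒≤ f-injective
iterC₃-transitive (suc k) = lexTransitive (iterC₃ k) (iterC₃-transitive k)

n≤3^n : ∀ n → n ≤ 3 ^ n
n≤3^n zero = z≤n
n≤3^n (suc n) = begin
  suc n             ≤⟨ +-mono-≤ (m^n>0 3 n) (n≤3^n n) ⟩
  3 ^ n + 3 ^ n     ≤⟨ +-monoʳ-≤ (3 ^ n) (m≤m+n (3 ^ n) _) ⟩
  3 * 3 ^ n         ∎
  where open ≤-Reasoning

-- `2 ^ k` is exactly the power of `3 ^ k` with exponent log₃ 2.
atMostRoot-2^ : ∀ k {m} → m ≤ 2 ^ k → AtMostRoot (3 ^ k) m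
atMostRoot-2^ k {m} m≤2^k = inj₂ λ p q 2^p≤3^q → begin
  m ^ p        ≤⟨ ^-monoˡ-≤ p m≤2^k ⟩
  (2 ^ k) ^ p  ≡⟨ swap 2 k p ⟩
  (2 ^ p) ^ k  ≤⟨ ^-monoˡ-≤ k 2^p≤3^q ⟩
  (3 ^ q) ^ k  ≡⟨ swap 3 q k ⟩
  (3 ^ k) ^ q  ∎
  where
  open ≤-Reasoning
  swap : ∀ a i j → (a ^ i) ^ j ≡ (a ^ j) ^ i
  swap a i j = trans (^-*-assoc a i j) (trans (cong (a ^_) (*-comm i j)) (sym (^-*-assoc a j i)))

theorem6p1 : ((n : ℕ) (G : Tournament n) → U5Free G →
    Σ ℕ λ m → Σ (Fin m → Fin n) λ f →
    Injective _≡_ _≡_ f × TransitiveOn G f × AtLeastRoot n m)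
    ×
    ((N : ℕ) → Σ ℕ λ n → N ≤ n × Σ (Tournament n) λ G → U5Free G ×
    ((m : ℕ) (f : Fin m → Fin n) → Injective _≡_ _≡_ f → TransitiveOn G f →
    AtMostRoot n m))
theorem6p1 = transitiveSubtournament
  , λ N → 3 ^ N , n≤3^n N , iterC₃ N , iterC₃-U5Free N
  , λ m f f-injective transitive → atMostRoot-2^ N (iterC₃-transitive N f f-injective transitive)
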